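{- Let $\mathcal M=(V,E,(V_0,V_1))$ be a game with winning condition given by generalized Rabin pairs $\{(F_1,\mathcal I_1),\ldots,(F_k,\mathcal I_k)\}$, and let $B$ be the corresponding degeneralization domain. For every vertex $v\in V$, Player 0 has a winning strategy from $v$ if and only if there are a good ranking $r$ and an element $b\in B$ with $r(v,b)\neq\infty$.
   Context: Game. A game $(V,E,(V_0,V_1))$ consists of a finite directed graph $(V,E)$ in which every vertex has an outgoing edge and a partition $(V_0,V_1)$ of $V$ into player-0 and player-1 vertices. Let $n=|V|$. A strategy of Player 0 assigns to each history (finite sequence of vertices) an outgoing edge of its last vertex. A play conforming to a strategy $f$ of Player 0 is an infinite sequence $v_0v_1\cdots$ with $(v_i,v_{i+1})\in E$ for all $i$, where the edge $(v_i,v_{i+1})$ is the one chosen by $f$ on $v_0\cdots v_i$ whenever $v_i\in V_0$. Winning condition. A generalized Rabin pair is $(F_i,\mathcal I_i)$ with $F_i\subseteq V$ and $\mathcal I_i=\{I_i^1,\ldots,I_i^{\ell_i}\}$, $I_i^j\subseteq V$; assume $k>0$ and $\ell_i>0$ for all $i$. A play $\rho$, with $\mathrm{Inf}(\rho)$ the set of vertices it visits infinitely often, satisfies the condition $\{(F_1,\mathcal I_1),\ldots,(F_k,\mathcal I_k)\}$ if there is $i\in\{1,\ldots,k\}$ with $F_i\cap\mathrm{Inf}(\rho)=\emptyset$ and $I_i^j\cap\mathrm{Inf}(\rho)\ne\emptyset$ for all $j\in\{1,\ldots,\ell_i\}$. Player 0 has a winning strategy from $v$ if there is a strategy of Player 0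 such that all plays starting in $v$ and conforming to it satisfy the condition. Degeneralization domain. $[1..\ell]=\{1,\ldots,\ell\}$ carries the cyclic successor $a\oplus 1=a+1$ for $a<\ell$ and $\ell\oplus1=1$. $B=\prod_{i=1}^k[1..\ell_i]$; for $b\in B$, $b(i)$ is its $i$th component. Rankings. The ranking domain is $R=\big(\{1,\ldots,k\}!\times\{0,\ldots,n\}^{k+1}\big)\cup\{\infty\}$, where $\{1,\ldots,k\}!$ is the set of permutations $\pi=\pi_1\cdots\pi_k$ of $\{1,\ldots,k\}$. A ranking is a function $r:V\times B\to R$. The total order $>_{lg}$ on $R$ compares elements $(\pi_1\cdots\pi_k,w_0w_1\cdots w_k)$ by the lexicographic order on $w_0\pi_1w_1\pi_2w_2\cdots\pi_kw_k$, with $\infty$ the greatest element. For $v\in V$ define $\mathrm{next}_v:B\to B$ by $\mathrm{next}_v(b)(i)=b(i)$ if $v\notin I_i^{b(i)}$ and $\mathrm{next}_v(b)(i)=b(i)\oplus1$ if $v\in I_i^{b(i)}$. For a ranking $r$ define $\mathrm{next}:V\times B\to R$ by $\mathrm{next}(v,b)=\min_{(v,w)\in E}r(w,\mathrm{next}_v(b))$ if $v\in V_0$, and $\mathrm{next}(v,b)=\max_{(v,w)\in E}r(w,\mathrm{next}_v(b))$ if $v\in V_1$, with min and max w.r.t. $>_{lg}$. Good rankings. For $v\in V$, $b\in B$ define $(\pi_1\cdots\pi_k,w_0w_1\cdots w_k)>_{v,b}(\pi'_1\cdots\pi'_k,w'_0w'_1\cdots w'_k)$ to hold if either $w_0>w_0'$,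 or $w_0=w_0'$ and $>^1_{v,b}$ holds. Recursively, for $1\le\ell\le k$, $>^\ell_{v,b}$ holds if one of the following holds: (1) $\pi_\ell>\pi'_\ell$; (2) $\pi_\ell=\pi'_\ell$, $v\notin F_{\pi_\ell}$ and $w_\ell>w'_\ell$; (3) $\pi_\ell=\pi'_\ell$, $v\notin F_{\pi_\ell}$ and $v\in I_{\pi_\ell}^{b(\pi_\ell)}$; (4) $\pi_\ell=\pi'_\ell$, $v\notin F_{\pi_\ell}$, $w_\ell=w'_\ell$ and $>^{\ell+1}_{v,b}$ holds; where $>^{k+1}_{v,b}$ never holds. An element of $R\setminus\{\infty\}$ is never $>_{v,b}\infty$. A ranking $r$ is good if for every $v\in V$, $b\in B$ with $r(v,b)\neq\infty$ we have $r(v,b)>_{v,b}\mathrm{next}(v,b)$. -}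

module Defs where

open import Data.Fin.Base using (Fin; zero; suc; toℕ; fromℕ<)
import Data.Fin.Base as Fin
open import Data.Fin.Permutation using (Permutation′; _⟨$⟩ʳ_)
open import Data.Fin.Subset using (Subset; _∈_; _∉_; ∁; Nonempty)
open import Data.Fin.Subset.Properties using (_∈?_)
open import Data.List.Base as List using (List; allFin; applyUpTo; filter)
import Data.List.Extrema as Extrema
open import Data.Nat.Base using (ℕ; zero; suc; _*_; _≤_; _<_; NonZero)
open import Data.Nat.Properties using (_<?_; ≤-decTotalOrder)
open import Data.Product.Base using (∃; _×_; _,_; proj₁)
open import Data.Sum.Base using (_⊎_)
open import Data.Vec.Base as Vec using (Vec; []; _∷_; lookup)
import Data.Vec.Relation.Binary.Lex.NonStrict as Lex
open import Data.Vec.Relation.Unary.All using (All)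
open import Data.Vec.Relation.Unary.All.Properties using (lookup⁺; lookup⁻)
open import Level using (0ℓ)
open import Relation.Binary.Bundles using (TotalOrder; DecTotalOrder)
import Relation.Binary.Construct.Add.Supremum.NonStrict as Supremum
import Relation.Binary.Construct.On as On
open import Relation.Binary.PropositionalEquality.Core using (_≡_; _≢_)
open import Relation.Nullary.Construct.Add.Supremum using (_⁺; ⊤⁺; [_])
open import Relation.Nullary.Decidable.Core using (Dec; yes; no)
open import Relation.Unary using (Pred; Empty; Satisfiable; _∩_)

-- The vertices are the elements of Fin n.
record Game (n : ℕ) : Set where
  field
    E       : Fin n → Subset n        -- E v = { w | (v , w) is an edge }
    E-total : ∀ v → Nonempty (E v)
    V₀      : Subset n

  V₁ : Subset n
  V₁ = ∁ V₀

record RabinPair (n : ℕ) : Set where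
  field
    F               : Subset n
    len             : ℕ
    .{{len-nonZero}} : NonZero len
    I               : Fin len → Subset n

Condition : ℕ → ℕ → Set
Condition n k = Vec (RabinPair n) k

module _ {n : ℕ} where

  Inf : (ℕ → Fin n) → Pred (Fin n) 0ℓ
  Inf ρ v = ∀ m → ∃ λ t → m ≤ t × ρ t ≡ v

  Satisfies : ∀ {k} → (ℕ → Fin n) → Condition n k → Set
  Satisfies {k} ρ α = ∃ λ (i : Fin k) → let open RabinPair (lookup α i) in
    Empty ((_∈ F) ∩ Inf ρ) × (∀ j → Satisfiable ((_∈ I j) ∩ Inf ρ))

module _ {n : ℕ} (M : Game n) where
  open Game M

  -- A history is a nonempty sequence; h is what precedes its last vertex v.
  Strategy : Set
  Strategy = (h : List (Fin n)) (v : Fin n) → ∃ λ w → w ∈ E v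

  record Conforms (f : Strategy) (ρ : ℕ → Fin n) : Set where
    field
      edge   : ∀ t → ρ (suc t) ∈ E (ρ t)
      follow : ∀ t → ρ t ∈ V₀ → ρ (suc t) ≡ proj₁ (f (applyUpTo ρ t) (ρ t))

  Winning : ∀ {k} → Condition n k → Strategy → Fin n → Set
  Winning α f v = ∀ ρ → ρ 0 ≡ v → Conforms f ρ → Satisfies ρ α

  Player0Wins : ∀ {k} → Condition n k → Fin n → Set
  Player0Wins α v = ∃ λ (f : Strategy) → Winning α f v

-- Cyclic successor.  Here, and for permutations below, {1,…,m} is
-- represented by Fin m, so all values are shifted down by one.
_⊕1 : ∀ {m} → Fin m → Fin m
_⊕1 {suc m} a with suc (toℕ a) <? suc m
... | yes a+1<m = fromℕ< a+1<m
... | no  _     = zero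

-- The product of the Fin ℓᵢ, as a heterogeneous vector.
DegenDomain : ∀ {n k} → Condition n k → Set
DegenDomain α = All (λ p → Fin (RabinPair.len p)) α

module _ {n k : ℕ} {α : Condition n k} where

  infixl 9 _!_
  _!_ : (b : DegenDomain α) (i : Fin k) → Fin (RabinPair.len (lookup α i))
  b ! i = lookup⁺ b i

  nextComponent : Fin n → DegenDomain α → (i : Fin k) → Fin (RabinPair.len (lookup α i))
  nextComponent v b i with v ∈? RabinPair.I (lookup α i) (b ! i)
  ... | yes _ = (b ! i) ⊕1
  ... | no  _ = b ! i

  nextᴮ : Fin n → DegenDomain α → DegenDomain α
  nextᴮ v b = lookup⁻ (nextComponent v b)

record FiniteRank (n k : ℕ) : Set where
  constructor ⟨_,_⟩
  field
    perm   : Permutation′ k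
    weight : Vec (Fin (suc n)) (suc k)

  π : Fin k → Fin k
  π ℓ = perm ⟨$⟩ʳ ℓ

  w : Fin (suc k) → Fin (suc n)
  w ℓ = lookup weight ℓ

  -- w₀ π₁ w₁ π₂ w₂ … πₖ wₖ
  sequence : Vec ℕ (suc (k * 2))
  sequence =
    toℕ (w zero) ∷ Vec.concat (Vec.tabulate λ ℓ → toℕ (π ℓ) ∷ toℕ (w (suc ℓ)) ∷ [])

Rank : ℕ → ℕ → Set
Rank n k = FiniteRank n k ⁺

pattern ∞ = ⊤⁺

-- The underlying equality identifies ranks with the same sequence, that is,
-- with pointwise equal permutations and equal weights.
finiteRankOrder : ℕ → ℕ → TotalOrder 0ℓ 0ℓ 0ℓ
finiteRankOrder n k = On.totalOrder
  (DecTotalOrder.totalOrder (Lex.≤-decTotalOrder ≤-decTotalOrder (suc (k * 2))))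
  (FiniteRank.sequence {n} {k})

rankOrder : ℕ → ℕ → TotalOrder 0ℓ 0ℓ 0ℓ
rankOrder n k = record
  { Carrier      = Rank n k
  ; isTotalOrder = Supremum.≤⁺-isTotalOrder _ (TotalOrder.isTotalOrder (finiteRankOrder n k))
  }

module _ {n k : ℕ} {α : Condition n k} (v : Fin n) (b : DegenDomain α) where
  open FiniteRank

  private
    F : Fin k → Subset n
    F i = RabinPair.F (lookup α i)

    I : (i : Fin k) → Fin (RabinPair.len (lookup α i)) → Subset n
    I i = RabinPair.I (lookup α i)

  -- Descends x y ℓ is x >^{ℓ+1}_{v,b} y.  Every constructor requires ℓ < k, so
  -- >^{k+1} is empty.
  data Descends (x y : FiniteRank n k) (ℓ : ℕ) : Set where
    perm-decreases : (ℓ<k : ℓ < k) → let i = fromℕ< ℓ<k in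
      π y i Fin.< π x i →
      Descends x y ℓ
    weight-decreases : (ℓ<k : ℓ < k) → let i = fromℕ< ℓ<k in
      π x i ≡ π y i → v ∉ F (π x i) → w y (suc i) Fin.< w x (suc i) →
      Descends x y ℓ
    visits : (ℓ<k : ℓ < k) → let i = fromℕ< ℓ<k in
      π x i ≡ π y i → v ∉ F (π x i) → v ∈ I (π x i) (b ! π x i) →
      Descends x y ℓ
    deeper : (ℓ<k : ℓ < k) → let i = fromℕ< ℓ<k in
      π x i ≡ π y i → v ∉ F (π x i) → w x (suc i) ≡ w y (suc i) →
      Descends x y (suc ℓ) →
      Descends x y ℓ

  FiniteDescends : (x y : FiniteRank n k) → Set
  FiniteDescends x y =
    w y zero Fin.< w x zero ⊎ (w x zero ≡ w y zero × Descends x y 0)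

  -- Only ranks other than ∞ are ever compared on the left, so nothing is said
  -- about that case.
  data RankDescends : Rank n k → Rank n k → Set where
    [_] : ∀ {x y} → FiniteDescends x y → RankDescends [ x ] [ y ]

module _ {n k : ℕ} (M : Game n) (α : Condition n k) where
  open Game M
  open Extrema (rankOrder n k) using (min; max)

  Ranking : Set
  Ranking = Fin n × DegenDomain α → Rank n k

  successors : Fin n → List (Fin n)
  successors v = filter (_∈? E v) (allFin n)

  -- min and max take an element and a list; the element is itself the value
  -- of some successor, hence does not affect the result.
  nextᴿ : Ranking → Ranking
  nextᴿ r (v , b) = choose (v ∈? V₀)
    where
    value : Fin n → Rank n k
    value u = r (u , nextᴮ v b)

    some : Rank n k
    some = value (proj₁ (E-total v))

    values : List (Rank n k)
    values = List.map value (successors v)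

    choose : Dec (v ∈ V₀) → Rank n k
    choose (yes _) = min some values
    choose (no  _) = max some values

  Good : Ranking → Set
  Good r = ∀ v b → r (v , b) ≢ ∞ → RankDescends v b (r (v , b)) (nextᴿ r (v , b))

{-# OPTIONS --safe #-}

-- Ranks from a winning strategy.  Player 0's winning region is a nested fixpoint
-- over sets of vertices, whose level ℓ iterates a least fixpoint (the weight
-- w_ℓ), chooses a pair (the index π_{ℓ+1}) and takes a greatest fixpoint over
-- it.  Every stage number is at most n because it counts a growing chain of
-- vertex sets, although rankings live on V × B.  The current targets b only
-- select which of the least fixpoints for the different targets of a pair is
-- measured: these all coincide, so a pair whose target has just been reached may
-- be measured afresh for its next target.  The rank is the least one certified
-- by these stages.  A vertex outside the fixpoint is lost, since against every
-- strategy the opponent can chain segments that visit each Fᵢ in turn.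
--
-- Winning from a ranking.  Player 0 moves to a successor of least rank.  Along a
-- play w₀, π₁, w₁, … become constant one after the other until some pair keeps
-- reaching its current target, which then cycles through all its targets.

module Submission where

open import Defs
open import Axiom.ExcludedMiddle using (ExcludedMiddle)
open import Data.Fin.Base as Fin
  using (Fin; zero; suc; toℕ; fromℕ; fromℕ<; inject₁; punchIn; punchOut)
open import Data.Fin.Permutation as Permutation using (Permutation′; _⟨$⟩ʳ_)
import Data.Fin.Properties as Finₚ
open import Data.Fin.Subset as Subset using (Subset; _∈_; _∉_; ∣_∣)
open import Data.Fin.Subset.Properties as Subsetₚ using (_∈?_)
open import Data.List.Base as List using (List; []; _∷ʳ_; allFin; applyUpTo; foldl)
import Data.List.Extrema as Extrema
open import Data.List.Membership.Propositional using () renaming (_∈_ to _∈ᴸ_)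
open import Data.List.Membership.Propositional.Properties
  using (∈-filter⁺; ∈-filter⁻; ∈-map⁺; ∈-map⁻; ∈-allFin)
import Data.List.Properties as Listₚ
import Data.List.Relation.Unary.All as Allᴸ
open import Data.Nat.Base
  using (ℕ; zero; suc; _+_; _*_; _∸_; _⊔_; _≤_; _<_; z≤n; s≤s; NonZero; >-nonZero⁻¹)
import Data.Nat.Properties as ℕₚ
open import Data.Product.Base using (∃; _×_; _,_; proj₁; proj₂)
open import Data.Sum.Base as Sum using (_⊎_; inj₁; inj₂)
open import Data.Unit.Base using (⊤; tt)
open import Data.Vec.Base as Vec using (Vec; []; _∷_; lookup)
import Data.Vec.Properties as Vecₚ
import Data.Vec.Relation.Binary.Lex.NonStrict as Lex
open import Data.Vec.Relation.Unary.All.Properties using (lookup⁺; lookup⁻)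
open import Function.Base using (_∘_; id)
open import Function.Bundles using (_⇔_; mk⇔)
open import Level using (0ℓ)
open import Relation.Binary.Bundles using (TotalOrder)
import Relation.Binary.Construct.Add.Supremum.NonStrict as Supremum
open import Relation.Binary.Construct.Closure.ReflexiveTransitive as Star
  using (Star; ε; _◅_; _◅◅_)
open import Relation.Binary.PropositionalEquality
  using (_≡_; _≢_; refl; sym; trans; cong; cong₂; subst; subst₂)
open import Relation.Nullary using (¬_; Dec; does; yes; no)
open import Relation.Nullary.Construct.Add.Supremum using ([_])
open import Relation.Nullary.Decidable using (decidable-stable; dec-true)
open import Relation.Nullary.Negation using (contradiction)
open import Relation.Unary using (Pred; _∪_; _∩_; _⊆_; ∅; U)

-- Descents survive lowering their target in the lexicographic order.

_≤ˡᵉˣ_ : ∀ {m} → Vec ℕ m → Vec ℕ m → Set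
_≤ˡᵉˣ_ = Lex.Lex-≤ _≡_ _≤_

interleave : ∀ {m} → (Fin m → ℕ) → (Fin m → ℕ) → Vec ℕ (m * 2)
interleave a b = Vec.concat (Vec.tabulate λ s → a s ∷ b s ∷ [])

-- For equal sequences d is the common length.
≤ˡᵉˣ⇒firstDifference : ∀ {m} (a b a′ b′ : Fin m → ℕ) → interleave a b ≤ˡᵉˣ interleave a′ b′ →
  ∃ λ d → (∀ s → toℕ s < d → a s ≡ a′ s × b s ≡ b′ s) ×
          (∀ s → toℕ s ≡ d → a s < a′ s ⊎ (a s ≡ a′ s × b s < b′ s))
≤ˡᵉˣ⇒firstDifference {zero} a b a′ b′ le = 0 , (λ ()) , λ ()
≤ˡᵉˣ⇒firstDifference {suc m} a b a′ b′ (Lex.this (le , ne) _) =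
  0 , (λ _ ()) , λ { zero _ → inj₁ (ℕₚ.≤∧≢⇒< le ne) }
≤ˡᵉˣ⇒firstDifference {suc m} a b a′ b′ (Lex.next eq (Lex.this (le , ne) _)) =
  0 , (λ _ ()) , λ { zero _ → inj₂ (eq , ℕₚ.≤∧≢⇒< le ne) }
≤ˡᵉˣ⇒firstDifference {suc m} a b a′ b′ (Lex.next eq (Lex.next eq′ le))
  with ≤ˡᵉˣ⇒firstDifference (a ∘ suc) (b ∘ suc) (a′ ∘ suc) (b′ ∘ suc) le
... | d , same , less =
  suc d
  , (λ { zero _ → eq , eq′ ; (suc s) (s≤s lt) → same s lt })
  , λ { (suc s) eq → less s (ℕₚ.suc-injective eq) }

module _ {n k : ℕ} {α : Condition n k} {v : Fin n} {b : DegenDomain α} where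
  open FiniteRank

  private
    _≤ˢ_ : FiniteRank n k → FiniteRank n k → Set
    z ≤ˢ y = sequence z ≤ˡᵉˣ sequence y

  -- Before `d`, where `z` first drops under `y`, every clause carries over unchanged. At `d` a
  -- smaller index gives `perm-decreases`; a smaller weight turns `deeper` into `weight-decreases`
  -- and preserves the other clauses, as `visits` does not compare weights.
  Descends-≥ : ∀ {x y z} d →
    (∀ s → toℕ s < d → toℕ (π z s) ≡ toℕ (π y s) × toℕ (w z (suc s)) ≡ toℕ (w y (suc s))) →
    (∀ s → toℕ s ≡ d → toℕ (π z s) < toℕ (π y s) ⊎
      (toℕ (π z s) ≡ toℕ (π y s) × toℕ (w z (suc s)) < toℕ (w y (suc s)))) →
    ∀ ℓ → ℓ ≤ d → Descends {α = α} v b x y ℓ → Descends {α = α} v b x z ℓ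
  Descends-≥ {x} {y} {z} d same less ℓ ℓ≤d desc with ℕₚ.m≤n⇒m<n∨m≡n ℓ≤d
  ... | inj₁ ℓ<d = step desc
    where
    agree : (ℓ<k : ℓ < k) → π z (fromℕ< ℓ<k) ≡ π y (fromℕ< ℓ<k) ×
                            w z (suc (fromℕ< ℓ<k)) ≡ w y (suc (fromℕ< ℓ<k))
    agree ℓ<k with same (fromℕ< ℓ<k) (subst (_< d) (sym (Finₚ.toℕ-fromℕ< ℓ<k)) ℓ<d)
    ... | p , q = Finₚ.toℕ-injective p , Finₚ.toℕ-injective q
    step : Descends {α = α} v b x y ℓ → Descends {α = α} v b x z ℓ
    step (perm-decreases ℓ<k lt) =
      perm-decreases ℓ<k (subst (Fin._< _) (sym (proj₁ (agree ℓ<k))) lt)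
    step (weight-decreases ℓ<k eq v∉F lt) =
      weight-decreases ℓ<k (trans eq (sym (proj₁ (agree ℓ<k)))) v∉F
        (subst (Fin._< _) (sym (proj₂ (agree ℓ<k))) lt)
    step (visits ℓ<k eq v∉F v∈I) = visits ℓ<k (trans eq (sym (proj₁ (agree ℓ<k)))) v∉F v∈I
    step (deeper ℓ<k eq v∉F eq′ desc) =
      deeper ℓ<k (trans eq (sym (proj₁ (agree ℓ<k)))) v∉F (trans eq′ (sym (proj₂ (agree ℓ<k))))
        (Descends-≥ d same less (suc ℓ) ℓ<d desc)
  ... | inj₂ ℓ≡d = step desc
    where
    smaller : (ℓ<k : ℓ < k) → let s = fromℕ< ℓ<k in
      toℕ (π z s) < toℕ (π y s) ⊎
      (toℕ (π z s) ≡ toℕ (π y s) × toℕ (w z (suc s)) < toℕ (w y (suc s)))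
    smaller ℓ<k = less (fromℕ< ℓ<k) (trans (Finₚ.toℕ-fromℕ< ℓ<k) ℓ≡d)
    step : Descends {α = α} v b x y ℓ → Descends {α = α} v b x z ℓ
    step (perm-decreases ℓ<k lt) with smaller ℓ<k
    ... | inj₁ lt′        = perm-decreases ℓ<k (ℕₚ.<-trans lt′ lt)
    ... | inj₂ (eq , _)   = perm-decreases ℓ<k (subst (_< _) (sym eq) lt)
    step (weight-decreases ℓ<k eq v∉F lt) with smaller ℓ<k
    ... | inj₁ lt′        = perm-decreases ℓ<k (subst (_ <_) (cong toℕ (sym eq)) lt′)
    ... | inj₂ (eq′ , lt′) =
      weight-decreases ℓ<k (trans eq (sym (Finₚ.toℕ-injective eq′))) v∉F (ℕₚ.<-trans lt′ lt)
    step (visits ℓ<k eq v∉F v∈I) with smaller ℓ<k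
    ... | inj₁ lt′        = perm-decreases ℓ<k (subst (_ <_) (cong toℕ (sym eq)) lt′)
    ... | inj₂ (eq′ , _)  = visits ℓ<k (trans eq (sym (Finₚ.toℕ-injective eq′))) v∉F v∈I
    step (deeper ℓ<k eq v∉F eq″ desc) with smaller ℓ<k
    ... | inj₁ lt′        = perm-decreases ℓ<k (subst (_ <_) (cong toℕ (sym eq)) lt′)
    ... | inj₂ (eq′ , lt′) =
      weight-decreases ℓ<k (trans eq (sym (Finₚ.toℕ-injective eq′))) v∉F
        (subst (_ <_) (cong toℕ (sym eq″)) lt′)

  FiniteDescends-≥ : ∀ {x y z} → FiniteDescends {α = α} v b x y → z ≤ˢ y →
    FiniteDescends {α = α} v b x z
  FiniteDescends-≥ (inj₁ lt) (Lex.this (le , _) _) = inj₁ (ℕₚ.≤-<-trans le lt)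
  FiniteDescends-≥ (inj₂ (eq , _)) (Lex.this (le , ne) _) =
    inj₁ (subst (_ <_) (cong toℕ (sym eq)) (ℕₚ.≤∧≢⇒< le ne))
  FiniteDescends-≥ (inj₁ lt) (Lex.next eq _) = inj₁ (subst (_< _) (sym eq) lt)
  FiniteDescends-≥ {x} {y} {z} (inj₂ (eq , desc)) (Lex.next eq′ le)
    with ≤ˡᵉˣ⇒firstDifference (toℕ ∘ π z) (toℕ ∘ w z ∘ suc) (toℕ ∘ π y) (toℕ ∘ w y ∘ suc) le
  ... | d , same , less =
    inj₂ (trans eq (sym (Finₚ.toℕ-injective eq′)) , Descends-≥ d same less 0 z≤n desc)

  -- Because of this, bounds on `min`, `max` and least ranks are enough in both directions of the
  -- theorem.
  RankDescends-≥ : ∀ {x y z} → RankDescends {α = α} v b x y →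
    TotalOrder._≤_ (rankOrder n k) z y → RankDescends {α = α} v b x z
  RankDescends-≥ [ desc ] Supremum.[ le ] = [ FiniteDescends-≥ desc le ]

-- Cyclic successor and update of the current targets.

toℕ-⊕1 : ∀ {m} (a : Fin (suc m)) → suc (toℕ a) < suc m → toℕ (a ⊕1) ≡ suc (toℕ a)
toℕ-⊕1 {m} a lt with suc (toℕ a) ℕₚ.<? suc m
... | yes lt′ = Finₚ.toℕ-fromℕ< lt′
... | no  ¬lt = contradiction lt ¬lt

max⊕1≡0 : ∀ m → fromℕ m ⊕1 ≡ zero
max⊕1≡0 m with suc (toℕ (fromℕ m)) ℕₚ.<? suc m
... | yes lt = contradiction (subst (λ x → suc x < suc m) (Finₚ.toℕ-fromℕ m) lt) (ℕₚ.<-irrefl refl)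
... | no  _  = refl

-- From `a` one climbs to the last element, wraps around to `zero`, and climbs again to `c`.
⊕1-induction : ∀ {m} (P : Fin m → Set) → (∀ a → P a → P (a ⊕1)) → ∀ {a} → P a → ∀ c → P c
⊕1-induction {suc m} P closed {a} pa c = up (toℕ c) zero c refl (subst P (max⊕1≡0 m) (closed _ pmax))
  where
  up : ∀ d a c → toℕ a + d ≡ toℕ c → P a → P c
  up zero    a c eq p = subst P (Finₚ.toℕ-injective (trans (sym (ℕₚ.+-identityʳ _)) eq)) p
  up (suc d) a c eq p = up d (a ⊕1) c (trans (cong (_+ d) (toℕ-⊕1 a lt)) eq′) (closed a p)
    where
    eq′ : suc (toℕ a) + d ≡ toℕ c
    eq′ = trans (sym (ℕₚ.+-suc (toℕ a) d)) eq
    lt : suc (toℕ a) < suc m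
    lt = ℕₚ.≤-<-trans (subst (suc (toℕ a) ≤_) eq′ (ℕₚ.m≤m+n _ d)) (Finₚ.toℕ<n c)

  pmax : P (fromℕ m)
  pmax = up (m ∸ toℕ a) a (fromℕ m)
    (trans (ℕₚ.m+[n∸m]≡n (ℕₚ.≤-pred (Finₚ.toℕ<n a))) (sym (Finₚ.toℕ-fromℕ m))) pa

module _ {n k : ℕ} {α : Condition n k} where
  nextᴮ-! : ∀ v (b : DegenDomain α) i → nextᴮ v b ! i ≡ nextComponent v b i
  nextᴮ-! v b = lookup⁺∘lookup⁻ {P = λ p → Fin (RabinPair.len p)} {xs = α} (nextComponent v b)
    where
    lookup⁺∘lookup⁻ : ∀ {A : Set} {P : A → Set} {m} {xs : Vec A m} (f : ∀ i → P (lookup xs i)) →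
      ∀ i → lookup⁺ (lookup⁻ {P = P} {xs = xs} f) i ≡ f i
    lookup⁺∘lookup⁻ {xs = _ ∷ _}          f zero    = refl
    lookup⁺∘lookup⁻ {P = P} {xs = _ ∷ xs} f (suc i) = lookup⁺∘lookup⁻ {P = P} {xs = xs} (f ∘ suc) i

  nextᴮ-∈ : ∀ v (b : DegenDomain α) i → v ∈ RabinPair.I (lookup α i) (b ! i) → nextᴮ v b ! i ≡ (b ! i) ⊕1
  nextᴮ-∈ v b i v∈I = trans (nextᴮ-! v b i) lemma
    where
    lemma : nextComponent v b i ≡ (b ! i) ⊕1
    lemma with v ∈? RabinPair.I (lookup α i) (b ! i)
    ... | yes _  = refl
    ... | no v∉I = contradiction v∈I v∉I

  nextᴮ-∉ : ∀ v (b : DegenDomain α) i → v ∉ RabinPair.I (lookup α i) (b ! i) → nextᴮ v b ! i ≡ b ! i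
  nextᴮ-∉ v b i v∉I = trans (nextᴮ-! v b i) lemma
    where
    lemma : nextComponent v b i ≡ b ! i
    lemma with v ∈? RabinPair.I (lookup α i) (b ! i)
    ... | yes v∈I = contradiction v∈I v∉I
    ... | no _    = refl

-- Minimum and maximum over the successors of a vertex.

module _ {n k : ℕ} {M : Game n} {α : Condition n k} (r : Ranking M α) where
  open Game M
  private
    open module R = TotalOrder (rankOrder n k) using () renaming (_≤_ to _≤ᴿ_)
    module Ex = Extrema (rankOrder n k)

    value : Fin n → DegenDomain α → Fin n → Rank n k
    value v b u = r (u , nextᴮ v b)

  nextᴿ-V₀-≤ : ∀ {v b u} → v ∈ V₀ → u ∈ E v → nextᴿ M α r (v , b) ≤ᴿ value v b u
  nextᴿ-V₀-≤ {v} {b} {u} v∈V₀ u∈E with v ∈? V₀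
  ... | no v∉V₀ = contradiction v∈V₀ v∉V₀
  ... | yes _   = Allᴸ.lookup (Ex.min≤xs _ (List.map (value v b) (successors M α v)))
                    (∈-map⁺ (value v b) (∈-filter⁺ (_∈? E v) (∈-allFin u) u∈E))

  nextᴿ-V₁-≥ : ∀ {v b u} → v ∉ V₀ → u ∈ E v → value v b u ≤ᴿ nextᴿ M α r (v , b)
  nextᴿ-V₁-≥ {v} {b} {u} v∉V₀ u∈E with v ∈? V₀
  ... | yes v∈V₀ = contradiction v∈V₀ v∉V₀
  ... | no _     = Allᴸ.lookup (Ex.xs≤max _ (List.map (value v b) (successors M α v)))
                     (∈-map⁺ (value v b) (∈-filter⁺ (_∈? E v) (∈-allFin u) u∈E))

  -- Provides Player 0's move in the winning strategy, and at a vertex of Player 1 the worst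
  -- successor, against which goodness is checked.
  nextᴿ-attained : ∀ v b → ∃ λ u → u ∈ E v × nextᴿ M α r (v , b) ≡ value v b u
  nextᴿ-attained v b = attained
    where
    xs = List.map (value v b) (successors M α v)
    fromList : ∀ {x} → x ∈ᴸ xs → ∃ λ u → u ∈ E v × x ≡ value v b u
    fromList x∈ with ∈-map⁻ (value v b) x∈
    ... | u , u∈ , eq = u , proj₂ (∈-filter⁻ (_∈? E v) {xs = allFin n} u∈) , eq
    attained : ∃ λ u → u ∈ E v × nextᴿ M α r (v , b) ≡ value v b u
    attained with v ∈? V₀
    ... | yes _ with Ex.argmin-sel (λ x → x) (value v b (proj₁ (E-total v))) xs
    ...   | inj₁ eq = _ , proj₂ (E-total v) , eq
    ...   | inj₂ x∈ = fromList x∈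
    attained | no _ with Ex.argmax-sel (λ x → x) (value v b (proj₁ (E-total v))) xs
    ...   | inj₁ eq = _ , proj₂ (E-total v) , eq
    ...   | inj₂ x∈ = fromList x∈

-- Classical limit arguments on infinite sequences.

module Classical (em : ExcludedMiddle 0ℓ) where

  byContradiction : {P : Set} → ¬ ¬ P → P
  byContradiction = decidable-stable em

  Eventually InfinitelyOften : (ℕ → Set) → Set
  Eventually P      = ∃ λ N → ∀ t → N ≤ t → P t
  InfinitelyOften P = ∀ N → ∃ λ t → N ≤ t × P t

  ¬InfinitelyOften⇒Eventually¬ : ∀ {P} → ¬ InfinitelyOften P → Eventually (¬_ ∘ P)
  ¬InfinitelyOften⇒Eventually¬ ¬io = byContradiction λ ¬ev →
    ¬io λ N → byContradiction λ ¬∃ → ¬ev (N , λ t N≤t p → ¬∃ (t , N≤t , p))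

  least : ∀ {P : ℕ → Set} m → P m → ∃ λ m → P m × (∀ i → P i → m ≤ i)
  least zero p = zero , p , λ _ _ → z≤n
  least {P} (suc m) p with em {P 0}
  ... | yes p₀ = zero , p₀ , λ _ _ → z≤n
  ... | no ¬p₀ with least {P ∘ suc} m p
  ...   | l , q , min = suc l , q , λ
    { zero    p₀ → contradiction p₀ ¬p₀
    ; (suc i) pᵢ → s≤s (min i pᵢ) }

  leastˡᵉˣ : ∀ {m} {P : Vec ℕ m → Set} xs → P xs → ∃ λ xs → P xs × (∀ ys → P ys → xs ≤ˡᵉˣ ys)
  leastˡᵉˣ [] p = [] , p , λ { [] _ → Lex.base tt }
  leastˡᵉˣ {P = P} (x ∷ xs) p with least {λ a → ∃ λ as → P (a ∷ as)} x (xs , p)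
  ... | a , (as , q) , min with leastˡᵉˣ {P = λ as → P (a ∷ as)} as q
  ...   | bs , q′ , min′ = a ∷ bs , q′ , below
    where
    below : ∀ ys → P ys → (a ∷ bs) ≤ˡᵉˣ ys
    below (y ∷ ys) p with em {a ≡ y}
    ... | yes refl = Lex.next refl (min′ ys p)
    ... | no a≢y   = Lex.this (min y (ys , p) , a≢y) refl

  -- From the moment at which the least value beyond `N` is attained, `f` can neither rise nor fall.
  eventuallyConstant : ∀ (f : ℕ → ℕ) N → (∀ t → N ≤ t → f (suc t) ≤ f t) →
    ∃ λ N′ → N ≤ N′ × (∀ t → N′ ≤ t → f t ≡ f N′)
  eventuallyConstant f N mono with least {λ m → ∃ λ t → N ≤ t × f t ≡ m} (f N) (N , ℕₚ.≤-refl , refl)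
  ... | _ , (N′ , N≤N′ , refl) , min =
    N′ , N≤N′ , λ t N′≤t → ℕₚ.≤-antisym
      (subst (λ t → f t ≤ f N′) (ℕₚ.m+[n∸m]≡n N′≤t) (decreasing (t ∸ N′)))
      (min (f t) (t , ℕₚ.≤-trans N≤N′ N′≤t , refl))
    where
    decreasing : ∀ s → f (N′ + s) ≤ f N′
    decreasing zero    = ℕₚ.≤-reflexive (cong f (ℕₚ.+-identityʳ N′))
    decreasing (suc s) = ℕₚ.≤-trans
      (ℕₚ.≤-reflexive (cong f (ℕₚ.+-suc N′ s)))
      (ℕₚ.≤-trans (mono (N′ + s) (ℕₚ.≤-trans N≤N′ (ℕₚ.m≤m+n N′ s))) (decreasing s))

  -- Phrased through times instead of `Inf`, and for a family over `Fin m`, so that a pair is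
  -- removed by composing with `punchIn`.
  Rabin : ∀ {n m} → (Fin m → RabinPair n) → (ℕ → Fin n) → Set
  Rabin β ρ = ∃ λ i →
    Eventually (λ t → ρ t ∉ RabinPair.F (β i)) ×
    (∀ j → InfinitelyOften (λ t → ρ t ∈ RabinPair.I (β i) j))

  eventually-∀ : ∀ {n} {Q : Fin n → ℕ → Set} → (∀ v → Eventually (Q v)) → Eventually (λ t → ∀ v → Q v t)
  eventually-∀ {zero}  ev = 0 , λ _ _ ()
  eventually-∀ {suc n} ev with ev zero | eventually-∀ (ev ∘ suc)
  ... | N , q | N′ , q′ = N ⊔ N′ , λ t le → λ
    { zero    → q t (ℕₚ.m⊔n≤o⇒m≤o N N′ le)
    ; (suc v) → q′ t (ℕₚ.m⊔n≤o⇒n≤o N N′ le) v }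

  module _ {n : ℕ} {P : Fin n → Set} {ρ : ℕ → Fin n} where
    -- Each vertex has its own last visit; as there are finitely many vertices, these bounds have a
    -- maximum.
    ¬Inf⇒Eventually¬ : (∀ v → P v → ¬ Inf ρ v) → Eventually (λ t → ¬ P (ρ t))
    ¬Inf⇒Eventually¬ avoids with eventually-∀ {Q = λ v t → P v → ρ t ≢ v} finite
      where
      finite : ∀ v → Eventually (λ t → P v → ρ t ≢ v)
      finite v with em {P v}
      ... | no ¬p = 0 , λ _ _ p → contradiction p ¬p
      ... | yes p with ¬InfinitelyOften⇒Eventually¬ (avoids v p)
      ...   | N , ne = N , λ t N≤t _ → ne t N≤t
    ... | N , ne = N , λ t N≤t p → ne t N≤t (ρ t) p refl

    InfinitelyOften⇒Inf : InfinitelyOften (λ t → P (ρ t)) → ∃ λ v → P v × Inf ρ v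
    InfinitelyOften⇒Inf io = byContradiction λ ¬∃ →
      let N , ¬p = ¬Inf⇒Eventually¬ (λ v p inf → ¬∃ (v , p , inf))
          t , N≤t , p = io N
      in ¬p t N≤t p

  module _ {n k : ℕ} {α : Condition n k} {ρ : ℕ → Fin n} where
    Rabin⇒Satisfies : Rabin (lookup α) ρ → Satisfies ρ α
    Rabin⇒Satisfies (i , (N , avoids) , io) =
      i
      , (λ { v (v∈F , inf) → let t , N≤t , eq = inf N in
             avoids t N≤t (subst (_∈ RabinPair.F (lookup α i)) (sym eq) v∈F) })
      , λ j → InfinitelyOften⇒Inf (io j)

    Satisfies⇒Rabin : Satisfies ρ α → Rabin (lookup α) ρ
    Satisfies⇒Rabin (i , empty , sat) =
      i
      , ¬Inf⇒Eventually¬ (λ v v∈F inf → empty v (v∈F , inf))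
      , λ j N → let v , v∈I , inf = sat j
                    t , N≤t , eq = inf N
                in t , N≤t , subst (_∈ RabinPair.I (lookup α i) j) (sym eq) v∈I

  -- Plays along which ranks descend satisfy a pair.

  module _ {n k : ℕ} {α : Condition n k} (ρ : ℕ → Fin n) (b : ℕ → DegenDomain α)
           (b-next : ∀ t → b (suc t) ≡ nextᴮ (ρ t) (b t)) where
    open FiniteRank

    private
      Hit : Fin k → ℕ → Set
      Hit i t = ρ t ∈ RabinPair.I (lookup α i) (b t ! i)

      b-hit : ∀ i t → Hit i t → b (suc t) ! i ≡ (b t ! i) ⊕1
      b-hit i t hit = trans (cong (_! i) (b-next t)) (nextᴮ-∈ (ρ t) (b t) i hit)

      b-miss : ∀ i t → ¬ Hit i t → b (suc t) ! i ≡ b t ! i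
      b-miss i t miss = trans (cong (_! i) (b-next t)) (nextᴮ-∉ (ρ t) (b t) i miss)

    -- The first hit from `N` on is a hit of the target current at `N`, since component `i` does not
    -- change before it; `s` bounds the search.
    hitWithCurrent : ∀ i N s → Hit i (s + N) → ∃ λ t → N ≤ t × Hit i t × b t ! i ≡ b N ! i
    hitWithCurrent i N zero hit = N , ℕₚ.≤-refl , hit , refl
    hitWithCurrent i N (suc s) hit with em {Hit i N}
    ... | yes hit′ = N , ℕₚ.≤-refl , hit′ , refl
    ... | no miss with hitWithCurrent i (suc N) s (subst (Hit i) (sym (ℕₚ.+-suc s N)) hit)
    ...   | t , N<t , hit′ , eq = t , ℕₚ.<⇒≤ N<t , hit′ , trans eq (b-miss i N miss)

    -- Each hit moves the target one step along the cycle, and the new target is hit again later, so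
    -- by `⊕1-induction` all of them occur beyond any `N`.
    hitsEveryTarget : ∀ i → InfinitelyOften (Hit i) → ∀ j →
      InfinitelyOften (λ t → ρ t ∈ RabinPair.I (lookup α i) j)
    hitsEveryTarget i io j N =
      let t , N≤t , hit , eq = ⊕1-induction P closed (hitNext N) j
      in t , N≤t , subst (λ j → ρ t ∈ RabinPair.I (lookup α i) j) eq hit
      where
      hitNext : ∀ N → ∃ λ t → N ≤ t × Hit i t × b t ! i ≡ b N ! i
      hitNext N with io N
      ... | t , N≤t , hit =
        hitWithCurrent i N (t ∸ N) (subst (Hit i) (sym (ℕₚ.m∸n+n≡m N≤t)) hit)
      P : Fin (RabinPair.len (lookup α i)) → Set
      P c = ∃ λ t → N ≤ t × Hit i t × b t ! i ≡ c
      closed : ∀ c → P c → P (c ⊕1)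
      closed c (t , N≤t , hit , refl) with hitNext (suc t)
      ... | t′ , t<t′ , hit′ , eq =
        t′ , ℕₚ.≤-trans N≤t (ℕₚ.<⇒≤ t<t′) , hit′ , trans eq (b-hit i t hit)

    module _ (x : ℕ → FiniteRank n k)
             (descends : ∀ t → FiniteDescends {α = α} (ρ t) (b t) (x t) (x (suc t))) where

      private
        DescendsFrom : ℕ → ℕ → Set
        DescendsFrom ℓ N = ∀ t → N ≤ t → Descends {α = α} (ρ t) (b t) (x t) (x (suc t)) ℓ

      -- m bounds the number of levels that remain.
      descends⇒Rabin : ∀ m ℓ N → k ≤ ℓ + m → DescendsFrom ℓ N → Rabin (lookup α) ρ
      descends⇒Rabin m ℓ N bound desc with ℓ ℕₚ.<? k
      ... | no ℓ≮k = contradiction (level (desc N ℕₚ.≤-refl)) ℓ≮k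
        where
        level : Descends {α = α} (ρ N) (b N) (x N) (x (suc N)) ℓ → ℓ < k
        level (perm-decreases ℓ<k _)         = ℓ<k
        level (weight-decreases ℓ<k _ _ _)   = ℓ<k
        level (visits ℓ<k _ _ _)             = ℓ<k
        level (deeper ℓ<k _ _ _ _)           = ℓ<k
      descends⇒Rabin zero ℓ N bound desc | yes ℓ<k =
        contradiction (ℕₚ.<-≤-trans ℓ<k (subst (k ≤_) (ℕₚ.+-identityʳ ℓ) bound)) (ℕₚ.<-irrefl refl)
      descends⇒Rabin (suc m) ℓ N bound desc | yes ℓ<k = conclude
        where
        s : Fin k
        s = fromℕ< ℓ<k

        π-mono : ∀ {t} → Descends {α = α} (ρ t) (b t) (x t) (x (suc t)) ℓ →
          toℕ (π (x (suc t)) s) ≤ toℕ (π (x t) s)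
        π-mono (perm-decreases _ lt)          = ℕₚ.<⇒≤ lt
        π-mono (weight-decreases _ eq _ _)    = ℕₚ.≤-reflexive (cong toℕ (sym eq))
        π-mono (visits _ eq _ _)              = ℕₚ.≤-reflexive (cong toℕ (sym eq))
        π-mono (deeper _ eq _ _ _)            = ℕₚ.≤-reflexive (cong toℕ (sym eq))

        -- No clause at this level raises the index, so it settles on some `i`.
        constant = eventuallyConstant (λ t → toℕ (π (x t) s)) N (λ t N≤t → π-mono (desc t N≤t))
        N₁ = proj₁ constant
        i = π (x N₁) s

        π≡i : ∀ t → N₁ ≤ t → π (x t) s ≡ i
        π≡i t N₁≤t = Finₚ.toℕ-injective (proj₂ (proj₂ constant) t N₁≤t)

        desc₁ : DescendsFrom ℓ N₁
        desc₁ t N₁≤t = desc t (ℕₚ.≤-trans (proj₁ (proj₂ constant)) N₁≤t)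

        data Cause (t : ℕ) : Set where
          hit    : Hit i t → Cause t
          lighter : toℕ (w (x (suc t)) (suc s)) < toℕ (w (x t) (suc s)) → Cause t
          deep   : w (x t) (suc s) ≡ w (x (suc t)) (suc s) →
                   Descends {α = α} (ρ t) (b t) (x t) (x (suc t)) (suc ℓ) → Cause t

        analyse : ∀ t → N₁ ≤ t → ρ t ∉ RabinPair.F (lookup α i) × Cause t
        analyse t N₁≤t with π≡i t N₁≤t | π≡i (suc t) (ℕₚ.m≤n⇒m≤1+n N₁≤t) | desc₁ t N₁≤t
        ... | eq | eq′ | perm-decreases _ lt =
          contradiction (subst₂ Fin._<_ eq′ eq lt) (ℕₚ.<-irrefl refl)
        ... | eq | _ | weight-decreases _ _ v∉F lt =
          subst (λ i → ρ t ∉ RabinPair.F (lookup α i)) eq v∉F , lighter lt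
        ... | eq | _ | visits _ _ v∉F v∈I =
          subst (λ i → ρ t ∉ RabinPair.F (lookup α i)) eq v∉F , hit (subst (λ i → Hit i t) eq v∈I)
        ... | eq | _ | deeper _ _ v∉F eq′ d =
          subst (λ i → ρ t ∉ RabinPair.F (lookup α i)) eq v∉F , deep eq′ d

        conclude : Rabin (lookup α) ρ
        -- Either `i` keeps hitting its current target and is satisfied, or the hits stop. Then the
        -- weight, which only a hit may raise, settles as well, and every descent happens one level
        -- deeper.
        conclude with em {InfinitelyOften (Hit i)}
        ... | yes io = i , (N₁ , λ t N₁≤t → proj₁ (analyse t N₁≤t)) , hitsEveryTarget i io
        ... | no ¬io with ¬InfinitelyOften⇒Eventually¬ ¬io
        ...   | N₂ , noHit = descends⇒Rabin m (suc ℓ) N₃ (subst (k ≤_) (ℕₚ.+-suc ℓ m) bound) desc₃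
          where
          w-mono : ∀ {t} → N₂ ≤ t → Cause t → toℕ (w (x (suc t)) (suc s)) ≤ toℕ (w (x t) (suc s))
          w-mono {t} le (hit h)   = contradiction h (noHit t le)
          w-mono le (lighter lt)   = ℕₚ.<⇒≤ lt
          w-mono le (deep eq _)   = ℕₚ.≤-reflexive (cong toℕ (sym eq))

          constantʷ = eventuallyConstant (λ t → toℕ (w (x t) (suc s))) (N₁ ⊔ N₂) λ t le →
            w-mono (ℕₚ.m⊔n≤o⇒n≤o N₁ N₂ le) (proj₂ (analyse t (ℕₚ.m⊔n≤o⇒m≤o N₁ N₂ le)))
          N₃ = proj₁ constantʷ

          desc₃ : DescendsFrom (suc ℓ) N₃
          desc₃ t N₃≤t
            with ℕₚ.≤-trans (proj₁ (proj₂ constantʷ)) N₃≤t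
          ... | le with proj₂ (analyse t (ℕₚ.m⊔n≤o⇒m≤o N₁ N₂ le))
          ...   | hit h     = contradiction h (noHit t (ℕₚ.m⊔n≤o⇒n≤o N₁ N₂ le))
          ...   | deep _ d  = d
          ...   | lighter lt = contradiction
            (trans (proj₂ (proj₂ constantʷ) (suc t) (ℕₚ.m≤n⇒m≤1+n N₃≤t))
                   (sym (proj₂ (proj₂ constantʷ) t N₃≤t)))
            (ℕₚ.<⇒≢ lt)

      finiteDescends⇒Rabin : Rabin (lookup α) ρ
      finiteDescends⇒Rabin = descends⇒Rabin k 0 N₀ ℕₚ.≤-refl desc₀
        where
        w₀-mono : ∀ {t} → FiniteDescends {α = α} (ρ t) (b t) (x t) (x (suc t)) →
          toℕ (w (x (suc t)) zero) ≤ toℕ (w (x t) zero)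
        w₀-mono (inj₁ lt)       = ℕₚ.<⇒≤ lt
        w₀-mono (inj₂ (eq , _)) = ℕₚ.≤-reflexive (cong toℕ (sym eq))

        constant = eventuallyConstant (λ t → toℕ (w (x t) zero)) 0 (λ t _ → w₀-mono (descends t))
        N₀ = proj₁ constant

        desc₀ : DescendsFrom 0 N₀
        desc₀ t N₀≤t with descends t
        ... | inj₂ (_ , d) = d
        ... | inj₁ lt = contradiction
          (trans (proj₂ (proj₂ constant) (suc t) (ℕₚ.m≤n⇒m≤1+n N₀≤t))
                 (sym (proj₂ (proj₂ constant) t N₀≤t)))
          (ℕₚ.<⇒≢ lt)

  -- From a good ranking to a winning strategy.

  module _ {n k : ℕ} (M : Game n) (α : Condition n k) (r : Ranking M α) (good : Good M α r)
           {v₀ : Fin n} {b₀ : DegenDomain α} (finite₀ : r (v₀ , b₀) ≢ ∞) where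
    open Game M

    private
      module R = TotalOrder (rankOrder n k)

      -- The current targets are a function of the history, so a strategy on histories can play on
      -- `V × B`.
      memory : List (Fin n) → DegenDomain α
      memory = foldl (λ b u → nextᴮ u b) b₀

      strategy : Strategy M
      strategy h v = let u , u∈E , _ = nextᴿ-attained {M = M} r v (memory h) in u , u∈E

    goodRanking⇒wins : Player0Wins M α v₀
    goodRanking⇒wins = strategy , wins
      where
      wins : Winning M α strategy v₀
      wins ρ ρ₀≡v₀ conforms = Rabin⇒Satisfies {α = α} (finiteDescends⇒Rabin ρ b b-next x descends)
        where
        open Conforms conforms
        b : ℕ → DegenDomain α
        b t = memory (applyUpTo ρ t)

        b-next : ∀ t → b (suc t) ≡ nextᴮ (ρ t) (b t)
        b-next t = trans (cong memory (sym (Listₚ.applyUpTo-∷ʳ ρ t)))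
                         (Listₚ.foldl-∷ʳ _ b₀ (ρ t) (applyUpTo ρ t))

        next≥ : ∀ t → r (ρ (suc t) , b (suc t)) R.≤ nextᴿ M α r (ρ t , b t)
        next≥ t = byCases (ρ t ∈? V₀)
          where
          byCases : Dec (ρ t ∈ V₀) → r (ρ (suc t) , b (suc t)) R.≤ nextᴿ M α r (ρ t , b t)
          byCases (no ρt∉V₀) =
            subst (λ b′ → r (ρ (suc t) , b′) R.≤ nextᴿ M α r (ρ t , b t))
              (sym (b-next t)) (nextᴿ-V₁-≥ r ρt∉V₀ (edge t))
          byCases (yes ρt∈V₀) = R.reflexive (R.Eq.reflexive
            (trans (cong₂ (λ u b′ → r (u , b′)) (follow t ρt∈V₀) (b-next t))
                   (sym (proj₂ (proj₂ (nextᴿ-attained {M = M} r (ρ t) (b t)))))))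

        rankDescends : ∀ t → r (ρ t , b t) ≢ ∞ →
          RankDescends {α = α} (ρ t) (b t) (r (ρ t , b t)) (r (ρ (suc t) , b (suc t)))
        rankDescends t finite = RankDescends-≥ (good (ρ t) (b t) finite) (next≥ t)

        target-finite : ∀ {v b x y} → RankDescends {α = α} v b x y → y ≢ ∞
        target-finite [ _ ] ()

        finite : ∀ t → r (ρ t , b t) ≢ ∞
        finite zero    = subst (λ v → r (v , b₀) ≢ ∞) (sym ρ₀≡v₀) finite₀
        finite (suc t) = target-finite (rankDescends t (finite t))

        fromFinite : (y : Rank n k) → y ≢ ∞ → ∃ λ x → y ≡ [ x ]
        fromFinite [ x ] _ = x , refl
        fromFinite ∞ ne    = contradiction refl ne

        x : ℕ → FiniteRank n k
        x t = proj₁ (fromFinite _ (finite t))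

        descends : ∀ t → FiniteDescends {α = α} (ρ t) (b t) (x t) (x (suc t))
        descends t = unwrap (subst₂ (RankDescends {α = α} (ρ t) (b t))
            (proj₂ (fromFinite _ (finite t))) (proj₂ (fromFinite _ (finite (suc t))))
            (rankDescends t (finite t)))
          where
          unwrap : ∀ {y z} → RankDescends {α = α} (ρ t) (b t) [ y ] [ z ] →
            FiniteDescends {α = α} (ρ t) (b t) y z
          unwrap [ d ] = d

-- Nested fixpoints over vertex sets and bounds on their stages.

module Fixpoints (em : ExcludedMiddle 0ℓ) {n : ℕ} (M : Game n) where
  open Game M
  open Classical em

  VertexSet : Set₁
  VertexSet = Pred (Fin n) 0ℓ

  toSubset : VertexSet → Subset n
  toSubset P = Vec.tabulate λ v → does (em {P v})

  ∈-toSubset⁺ : ∀ {P : VertexSet} {v} → P v → v ∈ toSubset P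
  ∈-toSubset⁺ {P} {v} p = Vecₚ.lookup⇒[]= v _
    (trans (Vecₚ.lookup∘tabulate _ v) (dec-true em p))

  ∈-toSubset⁻ : ∀ {P : VertexSet} {v} → v ∈ toSubset P → P v
  ∈-toSubset⁻ {P} {v} v∈ with em {P v} | trans (sym (Vecₚ.lookup∘tabulate _ v)) (Vecₚ.[]=⇒lookup v∈)
  ... | yes p | _ = p
  ... | no _  | ()

  -- The controllable predecessor: Player 0 can force the next vertex into `Q`.
  cpre : VertexSet → VertexSet
  cpre Q v = (v ∈ V₀ → ∃ λ u → u ∈ E v × Q u) × (v ∉ V₀ → ∀ {u} → u ∈ E v → Q u)

  cpre-mono : ∀ {P Q : VertexSet} → P ⊆ Q → cpre P ⊆ cpre Q
  cpre-mono P⊆Q (some , every) =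
    (λ v∈V₀ → let u , u∈E , p = some v∈V₀ in u , u∈E , P⊆Q p) , λ v∉V₀ u∈E → P⊆Q (every v∉V₀ u∈E)

  -- The approximants of μX. G (T ∪ (C ∩ cpre X)), starting from the empty set.
  stage : (VertexSet → VertexSet) → (C T : VertexSet) → ℕ → VertexSet
  stage G C T zero    = ∅
  stage G C T (suc w) = G (T ∪ (C ∩ cpre (stage G C T w)))

  solve : (VertexSet → VertexSet) → (C T : VertexSet) → VertexSet
  solve G C T v = ∃ λ w → stage G C T w v

  Monotone : (VertexSet → VertexSet) → Set₁
  Monotone G = ∀ {T T′ : VertexSet} → T ⊆ T′ → G T ⊆ G T′

  module Iteration (G : VertexSet → VertexSet) (G-mono : Monotone G) (C : VertexSet) where

    ∪-cpre-mono : ∀ (T T′ : VertexSet) {P P′ : VertexSet} → T ⊆ T′ → P ⊆ P′ → T ∪ (C ∩ cpre P) ⊆ T′ ∪ (C ∩ cpre P′)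
    ∪-cpre-mono T T′ T⊆T′ P⊆P′ = Sum.map T⊆T′ λ (c , p) → c , cpre-mono P⊆P′ p

    stage-mono : ∀ {T T′ : VertexSet} → T ⊆ T′ → ∀ w → stage G C T w ⊆ stage G C T′ w
    stage-mono {T} {T′} T⊆T′ (suc w) = G-mono (∪-cpre-mono T T′ T⊆T′ (stage-mono T⊆T′ w))

    solve-mono : ∀ {T T′ : VertexSet} → T ⊆ T′ → solve G C T ⊆ solve G C T′
    solve-mono T⊆T′ (w , p) = w , stage-mono T⊆T′ w p

    module _ {T : VertexSet} where

      stage-suc : ∀ w → stage G C T w ⊆ stage G C T (suc w)
      stage-suc (suc w) = G-mono (∪-cpre-mono T T id (stage-suc w))

      stage-≤ : ∀ {w w′} → w ≤ w′ → stage G C T w ⊆ stage G C T w′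
      stage-≤ {zero}  {w′}     _        = λ ()
      stage-≤ {suc w} {suc w′} (s≤s le) = G-mono (∪-cpre-mono T T id (stage-≤ le))

      private
        -- The stages grow strictly until they become stable, so this happens within n steps.
        stableOrLarge : ∀ w → (∃ λ w′ → w′ < w × stage G C T (suc w′) ⊆ stage G C T w′) ⊎
                              (w ≤ ∣ toSubset (stage G C T w) ∣)
        stableOrLarge zero = inj₂ z≤n
        stableOrLarge (suc w) with stableOrLarge w
        ... | inj₁ (w′ , w′<w , stable) = inj₁ (w′ , ℕₚ.m≤n⇒m≤1+n w′<w , stable)
        ... | inj₂ large with em {stage G C T (suc w) ⊆ stage G C T w}
        ...   | yes stable = inj₁ (w , ℕₚ.≤-refl , stable)
        ...   | no ¬stable = inj₂ (ℕₚ.≤-<-trans large (Subsetₚ.p⊂q⇒∣p∣<∣q∣ grows))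
          where
          grows : toSubset (stage G C T w) Subset.⊂ toSubset (stage G C T (suc w))
          grows = (λ v∈ → ∈-toSubset⁺ (stage-suc w (∈-toSubset⁻ v∈)))
                , byContradiction λ none → ¬stable λ {v} p → byContradiction λ ¬p →
                    none (v , ∈-toSubset⁺ p , λ v∈ → ¬p (∈-toSubset⁻ v∈))

        stableStage : ∃ λ w → w ≤ n × stage G C T (suc w) ⊆ stage G C T w
        stableStage with stableOrLarge (suc n)
        ... | inj₁ (w , w<1+n , stable) = w , ℕₚ.≤-pred w<1+n , stable
        -- Stage `suc n` would have more than `n` vertices.
        ... | inj₂ large =
          contradiction (ℕₚ.≤-trans large (Subsetₚ.∣p∣≤n (toSubset (stage G C T (suc n))))) (ℕₚ.<-irrefl refl)

      -- All stages lie inside the stable one, whose number is at most `n`. This is why weights up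
      -- to `n` are enough.
      solve⊆stage : solve G C T ⊆ stage G C T n
      solve⊆stage (w , p) = stage-≤ (proj₁ (proj₂ stableStage)) (below w p)
        where
        below : ∀ w → stage G C T w ⊆ stage G C T (proj₁ stableStage)
        below (suc w) p = proj₂ (proj₂ stableStage) (G-mono (∪-cpre-mono T T id (below w)) p)

      solve-closed : G (T ∪ (C ∩ cpre (solve G C T))) ⊆ solve G C T
      solve-closed p = suc n , G-mono (∪-cpre-mono T T id solve⊆stage) p

      -- Enlarging the target by vertices that already lead into the fixpoint gains nothing: by
      -- induction every stage for the larger target stays inside it.
      solve-idem : solve G C (T ∪ (C ∩ cpre (solve G C T))) ⊆ solve G C T
      solve-idem (w , p) = below w p
        where
        below : ∀ w → stage G C (T ∪ (C ∩ cpre (solve G C T))) w ⊆ solve G C T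
        below (suc w) p = solve-closed (G-mono
          Sum.[ id , (λ (c , q) → inj₂ (c , cpre-mono (below w) q)) ] p)

  stay : ∀ {m} → (Fin m → RabinPair n) → Fin m → VertexSet → VertexSet
  stay β i C = C ∩ (_∉ RabinPair.F (β i))

  -- The ways to finish a round of pair `i`: meet the outer target, or visit the `j`th set outside
  -- `Fᵢ` and move on into `Y`.
  exit : ∀ {m} (β : Fin m → RabinPair n) (i : Fin m) → VertexSet → VertexSet →
         Fin (RabinPair.len (β i)) → VertexSet → VertexSet
  exit β i C T j Y = T ∪ (stay β i C ∩ ((_∈ RabinPair.I (β i) j) ∩ cpre Y))

  -- The nested fixpoint
  --   solve β C T = μX. ⋃ᵢ νY. ⋂ⱼ solve (β ∖ i) (C ∖ Fᵢ) (T ∪ (C ∩ cpre X) ∪ ((C ∖ Fᵢ) ∩ Iᵢʲ ∩ cpre Y))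
  -- consists of the vertices from which Player 0 can reach T through C, or stay
  -- in C forever and satisfy one of the pairs β.
  step : ∀ m → (Fin m → RabinPair n) → VertexSet → VertexSet → VertexSet
  solveRest : ∀ {m} → (Fin (suc m) → RabinPair n) → Fin (suc m) → VertexSet → VertexSet → VertexSet

  -- A greatest fixpoint as the union of its post-fixpoints. Letting `Y` range over `Subset n`
  -- instead of predicates keeps it in `Set`.
  ν : ∀ {m} → (Fin (suc m) → RabinPair n) → Fin (suc m) → VertexSet → VertexSet → VertexSet
  ν β i C T v = ∃ λ (Y : Subset n) → v ∈ Y × (∀ j → (_∈ Y) ⊆ solveRest β i C (exit β i C T j (_∈ Y)))

  step zero    β C T   = T
  step (suc m) β C T v = ∃ λ i → ν β i C T v

  solveRest {m} β i C = solve (step m (β ∘ punchIn i) (stay β i C)) (stay β i C)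

  exit-mono : ∀ {m} (β : Fin m → RabinPair n) i j (C T T′ : VertexSet) {Y Y′ : VertexSet} → T ⊆ T′ → Y ⊆ Y′ →
    exit β i C T j Y ⊆ exit β i C T′ j Y′
  exit-mono β i j C T T′ T⊆T′ Y⊆Y′ = Sum.map T⊆T′ λ (c , v∈I , p) → c , v∈I , cpre-mono Y⊆Y′ p

  step-mono : ∀ m (β : Fin m → RabinPair n) C → Monotone (step m β C)
  step-mono zero    β C T⊆T′ p                  = T⊆T′ p
  step-mono (suc m) β C {T} {T′} T⊆T′ (i , Y , v∈Y , post) =
    i , Y , v∈Y , λ j u∈Y →
      Iteration.solve-mono (step m _ _) (step-mono m _ _) _ (exit-mono β i j C T T′ T⊆T′ id) (post j u∈Y)

  module Solve m (β : Fin m → RabinPair n) (C : VertexSet) =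
    Iteration (step m β C) (step-mono m β C) C

  module _ {m} (β : Fin (suc m) → RabinPair n) (i : Fin (suc m)) {C T : VertexSet} where
    private
      module Rest = Solve m (β ∘ punchIn i) (stay β i C)

      solveExit : Fin (RabinPair.len (β i)) → VertexSet
      solveExit j = solveRest β i C (exit β i C T j (ν β i C T))

    -- Knaster-Tarski: by monotonicity the union of the post-fixpoints is one itself.
    ν-unfold : ∀ j → ν β i C T ⊆ solveExit j
    ν-unfold j (Y , v∈Y , post) =
      Rest.solve-mono (exit-mono β i j C T T id λ u∈Y → Y , u∈Y , post) (post j v∈Y)

    -- Leaving Iᵢʲ into νY one can proceed to any other target j′, so each of the
    -- intersected sets is itself a post-fixpoint.
    ν-fold : ∀ j → solveExit j ⊆ ν β i C T
    ν-fold j p = toSubset (solveExit j) , ∈-toSubset⁺ p , λ j′ u∈ →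
      Rest.solve-mono (exit-mono β i j′ C T T id ∈-toSubset⁺) (postfixed j′ (∈-toSubset⁻ u∈))
      where
      postfixed : ∀ j′ → solveExit j ⊆ solveRest β i C (exit β i C T j′ (solveExit j))
      postfixed j′ q = Rest.solve-idem (Rest.solve-mono
        (λ { (inj₁ t) → inj₁ (inj₁ t)
           ; (inj₂ (c , _ , r)) → inj₂ (c , cpre-mono
               (λ s → Rest.solve-mono (exit-mono β i j′ C T T id (ν-unfold j)) (ν-unfold j′ s)) r) }) q)

  ⊆step : ∀ m (β : Fin m → RabinPair n) C {T : VertexSet} → T ⊆ step m β C T
  ⊆step zero    β C t = t
  -- `T` is contained in every exit set, hence a post-fixpoint for any pair, with stage 1 sufficing.
  ⊆step (suc m) β C {T} t = zero , toSubset T , ∈-toSubset⁺ t , λ j u∈ →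
    1 , ⊆step m _ _ (inj₁ (inj₁ (∈-toSubset⁻ u∈)))

-- Completeness of the nested fixpoint.

-- Paths that chain segments, the target of each segment being chosen by a
-- phase that advances cyclically.
module Scheduling {S : Set} {_⟶_ : S → S → Set} {Safe Fresh : S → Set} {m : ℕ}
  {G : Fin (suc m) → S → Set}
  (segment : ∀ φ s → Fresh s → ∃ λ u → Star (λ s s′ → Safe s × s ⟶ s′) s u ×
               G φ u × Safe u × ∃ λ s′ → u ⟶ s′ × Fresh s′)
  {s₀ : S} (fresh₀ : Fresh s₀) where

  private
    -- The current position with the unfinished rest of its segment and the edge on which the next
    -- segment will start.
    record State : Set where
      constructor state
      field
        phase       : Fin (suc m)
        position    : S
        {target}    : S
        path        : Star (λ s s′ → Safe s × s ⟶ s′) position target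
        reached     : G phase target
        safe        : Safe target
        {successor} : S
        leave       : target ⟶ successor
        fresh       : Fresh successor
    open State

    begin : Fin (suc m) → ∀ {s} → Fresh s → State
    begin φ {s} fresh with segment φ s fresh
    ... | u , path , reached , safe , s′ , leave , fresh′ = state φ s path reached safe leave fresh′

    advance : State → State
    advance (state φ s ε reached safe leave fresh)       = begin (φ ⊕1) fresh
    advance (state φ s (_ ◅ path) reached safe leave fresh) = state φ _ path reached safe leave fresh

    run : ℕ → State
    run zero    = begin zero fresh₀
    run (suc t) = advance (run t)

    advance-⟶ : ∀ x → position x ⟶ position (advance x)
    advance-⟶ (state φ s ε reached safe leave fresh)                = leave
    advance-⟶ (state φ s ((_ , st) ◅ path) reached safe leave fresh) = st

    position-safe : ∀ x → Safe (position x)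
    position-safe (state φ s ε reached safe leave fresh)                 = safe
    position-safe (state φ s ((safe′ , _) ◅ path) reached safe leave fresh) = safe′

    -- The remaining path is run to its end, where the goal of the phase is met and the phase
    -- advances.
    finish : ∀ {φ s u s′} (path : Star (λ s s′ → Safe s × s ⟶ s′) s u)
      {reached : G φ u} {safe : Safe u} {leave : u ⟶ s′} {fresh : Fresh s′} N →
      run N ≡ state φ s path reached safe leave fresh →
      ∃ λ t → N ≤ t × G φ (position (run t)) × phase (run (suc t)) ≡ φ ⊕1
    finish {φ} ε {reached} N eq =
      N , ℕₚ.≤-refl , subst (G φ ∘ position) (sym eq) reached , cong (phase ∘ advance) eq
    finish (_ ◅ path) N eq with finish path (suc N) (cong advance eq)
    ... | t , N<t , g , eq′ = t , ℕₚ.<⇒≤ N<t , g , eq′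

  play : ℕ → S
  play = position ∘ run

  play-⟶ : ∀ t → play t ⟶ play (suc t)
  play-⟶ t = advance-⟶ (run t)

  play-safe : ∀ t → Safe (play t)
  play-safe t = position-safe (run t)

  play-recurrent : ∀ φ N → ∃ λ t → N ≤ t × G φ (play t)
  play-recurrent φ N with ⊕1-induction P closed {phase (run N)} (N , ℕₚ.≤-refl , refl) φ
    where
    P : Fin (suc m) → Set
    P φ = ∃ λ t → N ≤ t × phase (run t) ≡ φ
    closed : ∀ φ → P φ → P (φ ⊕1)
    closed φ (t , N≤t , refl) with finish (path (run t)) t refl
    ... | t′ , t≤t′ , _ , eq = suc t′ , ℕₚ.≤-trans N≤t (ℕₚ.m≤n⇒m≤1+n t≤t′) , eq
  ... | t , N≤t , refl with finish (path (run t)) t refl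
  ...   | t′ , t≤t′ , g , _ = t′ , ℕₚ.≤-trans N≤t t≤t′ , g

-- A strategy of Player 0 enters only through the transition system of the
-- histories conforming to it.
module Completeness (em : ExcludedMiddle 0ℓ) {n : ℕ} (M : Game n)
  {S : Set} (label : S → Fin n) (_⟶_ : S → S → Set) (total : ∀ s → ∃ (s ⟶_))
  (cpre-⟶ : ∀ s (Y : Pred (Fin n) 0ℓ) → (∀ {s′} → s ⟶ s′ → Y (label s′)) →
             Fixpoints.cpre em M Y (label s)) where

  open Classical em
  open Fixpoints em M

  IsPath : (ℕ → S) → Set
  IsPath σ = ∀ t → σ t ⟶ σ (suc t)

  Achieves : ∀ {m} → (Fin m → RabinPair n) → (C T : VertexSet) → (ℕ → S) → Set
  Achieves β C T σ =
    (∃ λ t → T (label (σ t)) × (∀ t′ → t′ < t → C (label (σ t′)))) ⊎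
    ((∀ t → C (label (σ t))) × Rabin β (label ∘ σ))

  WinsFrom : ∀ {m} → (Fin m → RabinPair n) → (C T : VertexSet) → S → Set
  WinsFrom β C T s = ∀ σ → σ 0 ≡ s → IsPath σ → Achieves β C T σ

  somePath : S → ℕ → S
  somePath s zero    = s
  somePath s (suc t) = proj₁ (total (somePath s t))

  module Play {m} (β : Fin m → RabinPair n) (C T : VertexSet) where

    -- `WinsFrom` constrains only infinite paths; totality supplies one through `s`.
    WinsFrom⇒C : ∀ {s} → WinsFrom β C T s → ¬ T (label s) → C (label s)
    WinsFrom⇒C {s} wins ¬t with wins (somePath s) refl (λ t → proj₂ (total (somePath s t)))
    ... | inj₁ (zero , t , _)       = contradiction t ¬t
    ... | inj₁ (suc _ , _ , before) = before 0 (s≤s z≤n)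
    ... | inj₂ (always , _)         = always 0

    private
      prepend : S → (ℕ → S) → ℕ → S
      prepend s σ zero    = s
      prepend s σ (suc t) = σ t

      prepend-path : ∀ {s σ} → s ⟶ σ 0 → IsPath σ → IsPath (prepend s σ)
      prepend-path s⟶ path zero    = s⟶
      prepend-path s⟶ path (suc t) = path t

    WinsFrom-⟶ : ∀ {s s′} → WinsFrom β C T s → ¬ T (label s) → s ⟶ s′ → WinsFrom β C T s′
    WinsFrom-⟶ {s} wins ¬t s⟶s′ σ refl path with wins (prepend s σ) refl (prepend-path s⟶s′ path)
    ... | inj₁ (zero , t , _)       = contradiction t ¬t
    ... | inj₁ (suc r , t , before) = inj₁ (r , t , λ t′ lt → before (suc t′) (s≤s lt))
    ... | inj₂ (always , i , (N , avoids) , io) =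
      inj₂ (always ∘ suc , i , (N , λ t le → avoids (suc t) (ℕₚ.m≤n⇒m≤1+n le)) , λ j N → later (io j (suc N)))
      where
      later : ∀ {P : ℕ → Set} {N} → (∃ λ t → suc N ≤ t × P t) → ∃ λ t → N ≤ t × P (suc t)
      later (suc t , s≤s le , p) = t , le , p

    Safe : S → Set
    Safe s = C (label s) × ¬ T (label s)

    WinsFrom-Star : ∀ {s s′} → WinsFrom β C T s → Star (λ s s′ → Safe s × s ⟶ s′) s s′ → WinsFrom β C T s′
    WinsFrom-Star wins ε = wins
    WinsFrom-Star wins (((_ , ¬t) , st) ◅ path) = WinsFrom-Star (WinsFrom-⟶ wins ¬t st) path

    private
      Z : VertexSet
      Z = solve (step m β C) C T

    -- The would-be counterexamples to completeness: won, but outside the fixpoint.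
    Fresh : S → Set
    Fresh s = WinsFrom β C T s × ¬ Z (label s)

    open Solve m β C using (solve-closed)

    Fresh⇒Safe : ∀ {s} → Fresh s → Safe s
    Fresh⇒Safe (wins , ¬z) = WinsFrom⇒C wins ¬t , ¬t
      where ¬t = λ t → ¬z (solve-closed (⊆step m β C (inj₁ t)))

    -- If all successors had labels in `Z`, then `cpre-⟶` would put the label of `s` in `cpre Z`. A
    -- successor outside `Z` is still won, as `s` has not met `T`.
    escape : ∀ {s} → WinsFrom β C T s → ¬ T (label s) → ¬ cpre Z (label s) → ∃ λ s′ → s ⟶ s′ × Fresh s′
    escape {s} wins ¬t ¬cpre = byContradiction λ none → ¬cpre (cpre-⟶ s Z λ st →
      byContradiction λ ¬z → none (_ , st , WinsFrom-⟶ wins ¬t st , ¬z))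

    Fresh⇒¬cpre : ∀ {s} → Fresh s → ¬ cpre Z (label s)
    Fresh⇒¬cpre fresh@(_ , ¬z) p =
      ¬z (solve-closed (⊆step m β C (inj₂ (proj₁ (Fresh⇒Safe fresh) , p))))

    Safe-play⇒Rabin : ∀ {s} → WinsFrom β C T s → ∀ σ → σ 0 ≡ s → IsPath σ → (∀ t → Safe (σ t)) →
      Rabin β (label ∘ σ)
    Safe-play⇒Rabin wins σ σ₀ path safe with wins σ σ₀ path
    ... | inj₁ (t , p , _) = contradiction p (proj₂ (safe t))
    ... | inj₂ (_ , rabin) = rabin

  -- By induction on `m`. Otherwise `s` is `Fresh`; for every `i`, each `Fresh` state has a segment
  -- through `Fᵢ` to another `Fresh` state. Scheduling these cyclically gives a path in `C` that
  -- avoids `T` and violates every pair.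
  WinsFrom⇒solve : ∀ m (β : Fin m → RabinPair n) (C T : VertexSet) s →
    WinsFrom β C T s → solve (step m β C) C T (label s)

  module _ {m} (β : Fin (suc m) → RabinPair n) (C T : VertexSet) (i : Fin (suc m)) where
    open Play β C T
    private
      Z T′ C′ : VertexSet
      Z = solve (step (suc m) β C) C T
      T′ = T ∪ (C ∩ cpre Z)
      C′ = stay β i C

      Safe′ : S → Set
      Safe′ u = C′ (label u) × ¬ T′ (label u)

      _⟶ˢ_ _⟶′_ : S → S → Set
      u ⟶ˢ u′ = Safe u × u ⟶ u′
      u ⟶′ u′ = Safe′ u × u ⟶ u′

      weaken : ∀ {u u′} → u ⟶′ u′ → u ⟶ˢ u′
      weaken (((c , _) , ¬t′) , st) = (c , ¬t′ ∘ inj₁) , st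

    Segment : S → Set
    Segment s = ∃ λ u → Star (λ s s′ → Safe s × s ⟶ s′) s u ×
      label u ∈ RabinPair.F (β i) × Safe u × ∃ λ s′ → u ⟶ s′ × Fresh s′

    module _ {s : S} (fresh : Fresh s) (noSegment : ¬ Segment s) where
      private
        Y : Subset n
        Y = toSubset λ v → ∃ λ u → Star _⟶′_ s u × label u ≡ v

        -- A path that is `Safe′` forever satisfies some pair: another one than `i`, which wins the
        -- remaining problem, or `i` itself, which visits set `j` and thereby exits into `Y`. A path
        -- that stops being `Safe′` does so in `T′`, since stopping in `Fᵢ` would complete a
        -- segment.
        winsRest : ∀ j {u} → Star _⟶′_ s u →
          WinsFrom (β ∘ punchIn i) C′ (exit β i C T′ j (_∈ Y)) u
        winsRest j {u} path σ refl σ-path with em {∃ λ t → ¬ Safe′ (σ t)}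
        ... | no allSafe = always
          where
          safe′ : ∀ t → Safe′ (σ t)
          safe′ t = byContradiction λ ¬safe → allSafe (t , ¬safe)

          reach : ∀ t → Star _⟶′_ s (σ t)
          reach zero    = path
          reach (suc t) = reach t ◅◅ ((safe′ t , σ-path t) ◅ ε)

          always : Achieves (β ∘ punchIn i) C′ (exit β i C T′ j (_∈ Y)) σ
          always with Safe-play⇒Rabin (WinsFrom-Star (proj₁ fresh) (Star.map weaken path)) σ refl σ-path
                        (λ t → proj₁ (weaken (safe′ t , σ-path t)))
          ... | i′ , ev , io with i Finₚ.≟ i′
          ...   | no i≢i′ = inj₂ (proj₁ ∘ safe′ , punchOut i≢i′ ,
                  subst (λ i → Eventually (λ t → label (σ t) ∉ RabinPair.F (β i)) ×
                               (∀ j → InfinitelyOften (λ t → label (σ t) ∈ RabinPair.I (β i) j)))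
                        (sym (Finₚ.punchIn-punchOut i≢i′)) (ev , io))
          ...   | yes refl with io j 0
          ...     | t , _ , ∈I = inj₁ (t ,
                    inj₂ (proj₁ (safe′ t) , ∈I , cpre-⟶ (σ t) (_∈ Y) λ st →
                      ∈-toSubset⁺ (_ , reach t ◅◅ ((safe′ t , st) ◅ ε) , refl)) ,
                    λ t′ _ → proj₁ (safe′ t′))
        ... | yes (t , ¬safe) with least {λ t → ¬ Safe′ (σ t)} t ¬safe
        ...   | t₀ , ¬safe₀ , min = atExit em
          where
          before : ∀ t → t < t₀ → Safe′ (σ t)
          before t t<t₀ = byContradiction λ ¬safe → ℕₚ.<⇒≱ t<t₀ (min t ¬safe)

          reach : ∀ t → t ≤ t₀ → Star _⟶′_ s (σ t)
          reach zero    _    = path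
          reach (suc t) t<t₀ = reach t (ℕₚ.<⇒≤ t<t₀) ◅◅ ((before t t<t₀ , σ-path t) ◅ ε)

          path₀ = Star.map weaken (reach t₀ ℕₚ.≤-refl)
          wins₀ = WinsFrom-Star (proj₁ fresh) path₀

          -- Outside T′ the vertex at t₀ lies in C, hence in Fᵢ, and a step out
          -- of Z completes a segment.
          atExit : Dec (T′ (label (σ t₀))) →
            Achieves (β ∘ punchIn i) C′ (exit β i C T′ j (_∈ Y)) σ
          atExit (yes t′) = inj₁ (t₀ , inj₁ t′ , λ t lt → proj₁ (before t lt))
          atExit (no ¬t′) = contradiction
            (σ t₀ , path₀ , ∈F , (c₀ , ¬t′ ∘ inj₁) ,
              escape wins₀ (¬t′ ∘ inj₁) (λ p → ¬t′ (inj₂ (c₀ , p))))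
            noSegment
            where
            c₀ = WinsFrom⇒C wins₀ (¬t′ ∘ inj₁)
            ∈F : label (σ t₀) ∈ RabinPair.F (β i)
            ∈F = byContradiction λ ∉F → ¬safe₀ ((c₀ , ∉F) , ¬t′)

      -- The labels reachable by `Safe′` steps form a post-fixpoint for pair `i`: one state per
      -- label is enough, and the induction hypothesis applies to it by `winsRest`.
      noSegment⇒solve : Z (label s)
      noSegment⇒solve = Solve.solve-closed (suc m) β C
        (i , Y , ∈-toSubset⁺ (s , ε , refl) , λ j v∈Y → post j (∈-toSubset⁻ v∈Y))
        where
        post : ∀ j {v} → (∃ λ u → Star _⟶′_ s u × label u ≡ v) → solveRest β i C (exit β i C T′ j (_∈ Y)) v
        post j (u , path , refl) = WinsFrom⇒solve m _ _ _ u (winsRest j path)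

  WinsFrom⇒solve zero β C T s wins = byContradiction λ ¬z → impossible (wins , ¬z)
    where
    open Play β C T
    impossible : ¬ Fresh s
    impossible fresh with Safe-play⇒Rabin wins play refl play-⟶ play-safe
      where
      -- Without pairs, empty segments with a trivial goal keep the play outside `Z` forever, and no
      -- pair can be satisfied.
      open Scheduling {_⟶_ = _⟶_} {Safe = Safe} {Fresh = Fresh} {m = 0} {G = λ _ _ → ⊤}
        (λ _ s fresh → s , ε , tt , Fresh⇒Safe fresh ,
          escape (proj₁ fresh) (proj₂ (Fresh⇒Safe fresh)) (Fresh⇒¬cpre fresh)) fresh
    ... | () , _
  WinsFrom⇒solve (suc m) β C T s wins = byContradiction λ ¬z → impossible (wins , ¬z)
    where
    open Play β C T
    impossible : ¬ Fresh s
    impossible fresh = let i , (N , avoids) , _ = Safe-play⇒Rabin wins play refl play-⟶ play-safe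
                           t , N≤t , ∈F = play-recurrent i N
                       in avoids t N≤t ∈F
      where
      open Scheduling {_⟶_ = _⟶_} {Safe = Safe} {Fresh = Fresh} {G = λ i u → label u ∈ RabinPair.F (β i)}
        (λ i s fresh → byContradiction λ none → proj₂ fresh (noSegment⇒solve β C T i fresh none)) fresh

-- Tree-shaped ranks and their descent.

-- A rank whose permutation is given by successive choices among the indices
-- that remain.
data TreeRank (n : ℕ) : ℕ → Set where
  leaf : Fin (suc n) → TreeRank n 0
  node : ∀ {m} → Fin (suc n) → Fin (suc m) → TreeRank n m → TreeRank n (suc m)

module _ {n : ℕ} where

  -- `insert zero i` sends `zero` to `i` and later positions through `punchIn i`, just as the
  -- fixpoint removes pair `i`.
  permutation : ∀ {m} → TreeRank n m → Permutation′ m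
  permutation (leaf w)     = Permutation.id
  permutation (node w i x) = Permutation.insert zero i (permutation x)

  weights : ∀ {m} → TreeRank n m → Vec (Fin (suc n)) (suc m)
  weights (leaf w)     = w ∷ []
  weights (node w i x) = w ∷ weights x

  headWeight : ∀ {m} → TreeRank n m → Fin (suc n)
  headWeight x = lookup (weights x) zero

  toFiniteRank : ∀ {m} → TreeRank n m → FiniteRank n m
  toFiniteRank x = ⟨ permutation x , weights x ⟩

  Targets : ∀ {m} → (Fin m → RabinPair n) → Set
  Targets β = ∀ i → Fin (RabinPair.len (β i))

  -- Descent as the fixpoints produce it: at each level the weight drops or the index is kept. Drops
  -- of the index arise only on passing to least ranks.
  data TreeDescends (v : Fin n) :
    ∀ {m} (β : Fin m → RabinPair n) → Targets β → (x y : TreeRank n m) → Set where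
    head-decreases : ∀ {m} {β : Fin m → RabinPair n} {b x y} →
      headWeight y Fin.< headWeight x → TreeDescends v β b x y
    visits : ∀ {m} {β : Fin (suc m) → RabinPair n} {b w i x y} →
      v ∉ RabinPair.F (β i) → v ∈ RabinPair.I (β i) (b i) →
      TreeDescends v β b (node w i x) (node w i y)
    deeper : ∀ {m} {β : Fin (suc m) → RabinPair n} {b w i x y} →
      v ∉ RabinPair.F (β i) → TreeDescends v (β ∘ punchIn i) (b ∘ punchIn i) x y →
      TreeDescends v β b (node w i x) (node w i y)

  module _ {k} {α : Condition n k} {v : Fin n} {b : DegenDomain α} where
    open FiniteRank

    -- x is the part of X from level ℓ on, with its indices renamed along e.
    record Suffix (ℓ : ℕ) {m} (e : Fin m → Fin k) (X : FiniteRank n k) (x : TreeRank n m) : Set where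
      field
        π-suffix : ∀ s t → toℕ s ≡ ℓ + toℕ t → π X s ≡ e (permutation x ⟨$⟩ʳ t)
        w-suffix : ∀ s t → toℕ s ≡ ℓ + toℕ t → w X (suc s) ≡ lookup (weights x) (suc t)
    open Suffix

    Suffix-suc : ∀ {ℓ m} {e : Fin (suc m) → Fin k} {X w i x} →
      Suffix ℓ e X (node w i x) → Suffix (suc ℓ) (e ∘ punchIn i) X x
    Suffix-suc {ℓ} suffix .π-suffix s t eq = π-suffix suffix s (suc t) (trans eq (sym (ℕₚ.+-suc ℓ (toℕ t))))
    Suffix-suc {ℓ} suffix .w-suffix s t eq = w-suffix suffix s (suc t) (trans eq (sym (ℕₚ.+-suc ℓ (toℕ t))))

    Suffix-zero : ∀ {ℓ m} → ℓ + suc m ≡ k → ∀ {e : Fin (suc m) → Fin k} {X w₀ i x} →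
      Suffix ℓ e X (node w₀ i x) → (ℓ<k : ℓ < k) →
      π X (fromℕ< ℓ<k) ≡ e i × w X (suc (fromℕ< ℓ<k)) ≡ headWeight x
    Suffix-zero {ℓ} eq suffix ℓ<k = π-suffix suffix _ zero s≡ℓ , w-suffix suffix _ zero s≡ℓ
      where
      s≡ℓ : toℕ (fromℕ< ℓ<k) ≡ ℓ + 0
      s≡ℓ = trans (Finₚ.toℕ-fromℕ< ℓ<k) (sym (ℕₚ.+-identityʳ ℓ))

    -- The head weight of a suffix is compared by the clauses one level up, whence the disjunction:
    -- its cases become `weight-decreases` and `deeper` there, and the two cases of `FiniteDescends`
    -- at the top.
    TreeDescends⇒Descends : ∀ {m} ℓ → ℓ + m ≡ k → (e : Fin m → Fin k) → ∀ {X Y x y} →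
      Suffix ℓ e X x → Suffix ℓ e Y y → TreeDescends v (lookup α ∘ e) ((b !_) ∘ e) x y →
      headWeight y Fin.< headWeight x ⊎ (headWeight x ≡ headWeight y × Descends {α = α} v b X Y ℓ)
    TreeDescends⇒Descends ℓ eq e sx sy (head-decreases lt) = inj₁ lt
    TreeDescends⇒Descends {suc m} ℓ eq e {X} {Y} sx sy (visits v∉F v∈I) = inj₂ (refl , result)
      where
      ℓ<k = ℕₚ.m+n≤o⇒m≤o (suc ℓ) (ℕₚ.≤-reflexive (trans (sym (ℕₚ.+-suc ℓ m)) eq))
      πX = proj₁ (Suffix-zero eq sx ℓ<k)
      πY = proj₁ (Suffix-zero eq sy ℓ<k)
      result : Descends {α = α} v b X Y ℓ
      result = Descends.visits ℓ<k (trans πX (sym πY))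
        (subst (λ i → v ∉ RabinPair.F (lookup α i)) (sym πX) v∉F)
        (subst (λ i → v ∈ RabinPair.I (lookup α i) (b ! i)) (sym πX) v∈I)
    TreeDescends⇒Descends {suc m} ℓ eq e {X} {Y} sx sy (deeper v∉F desc) = inj₂ (refl , result)
      where
      ℓ<k = ℕₚ.m+n≤o⇒m≤o (suc ℓ) (ℕₚ.≤-reflexive (trans (sym (ℕₚ.+-suc ℓ m)) eq))
      πX = proj₁ (Suffix-zero eq sx ℓ<k)
      πY = proj₁ (Suffix-zero eq sy ℓ<k)
      wX = proj₂ (Suffix-zero eq sx ℓ<k)
      wY = proj₂ (Suffix-zero eq sy ℓ<k)
      v∉FX = subst (λ i → v ∉ RabinPair.F (lookup α i)) (sym πX) v∉F
      result : Descends {α = α} v b X Y ℓ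
      result with TreeDescends⇒Descends (suc ℓ) (trans (sym (ℕₚ.+-suc ℓ m)) eq) _
                    (Suffix-suc sx) (Suffix-suc sy) desc
      ... | inj₁ lt         = weight-decreases ℓ<k (trans πX (sym πY)) v∉FX
                                (subst₂ Fin._<_ (sym wY) (sym wX) lt)
      ... | inj₂ (eqʷ , d)  = Descends.deeper ℓ<k (trans πX (sym πY)) v∉FX
                                (trans wX (trans eqʷ (sym wY))) d

    TreeDescends⇒FiniteDescends : ∀ {x y} → TreeDescends v (lookup α) (b !_) x y →
      FiniteDescends {α = α} v b (toFiniteRank x) (toFiniteRank y)
    TreeDescends⇒FiniteDescends = TreeDescends⇒Descends 0 refl id whole whole
      where
      whole : ∀ {x} → Suffix 0 id (toFiniteRank x) x
      whole {x} .π-suffix s t eq = cong (permutation x ⟨$⟩ʳ_) (Finₚ.toℕ-injective eq)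
      whole {x} .w-suffix s t eq = cong (lookup (weights x) ∘ suc) (Finₚ.toℕ-injective eq)

-- Ranks certified by the fixpoint, and the least such ranking.

module Ranks (em : ExcludedMiddle 0ℓ) {n : ℕ} (M : Game n) where
  open Game M
  open Classical em
  open Fixpoints em M

  below : ∀ m → (Fin m → RabinPair n) → (C T : VertexSet) → Fin (suc n) → VertexSet
  below m β C T w = T ∪ (C ∩ cpre (stage (step m β C) C T (toℕ w)))

  -- Weight w stands for stage w + 1.
  Certifies : ∀ {m} (β : Fin m → RabinPair n) → Targets β → (C T : VertexSet) → TreeRank n m → VertexSet
  Certifies β b C T (leaf w) v = below 0 β C T w v
  Certifies {suc m} β b C T (node w i x) v =
    let T′ = below (suc m) β C T w in
    ν β i C T′ v ×
    Certifies (β ∘ punchIn i) (b ∘ punchIn i) (stay β i C) (exit β i C T′ (b i) (ν β i C T′)) x v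

  Certifies⇒solve : ∀ {m} (β : Fin m → RabinPair n) b C T x {v} →
    Certifies β b C T x v → solve (step m β C) C T v
  Certifies⇒solve β b C T (leaf w)     p       = suc (toℕ w) , p
  Certifies⇒solve β b C T (node w i x) (p , _) = suc (toℕ w) , i , p

  solve⇒Certifies : ∀ m (β : Fin m → RabinPair n) b C T {v} →
    solve (step m β C) C T v → ∃ λ x → Certifies β b C T x v

  ν⇒Certifies : ∀ {m} (β : Fin (suc m) → RabinPair n) b C T w i {v} →
    ν β i C (below (suc m) β C T w) v → ∃ λ x → Certifies β b C T (node w i x) v
  ν⇒Certifies {m} β b C T w i p =
    let x , cert = solve⇒Certifies m _ (b ∘ punchIn i) _ _ (ν-unfold β i (b i) p) in x , p , cert

  stage⇒Certifies : ∀ m (β : Fin m → RabinPair n) b C T w {v} →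
    stage (step m β C) C T (suc (toℕ w)) v → ∃ λ x → headWeight x ≡ w × Certifies β b C T x v
  stage⇒Certifies zero    β b C T w p       = leaf w , refl , p
  stage⇒Certifies (suc m) β b C T w (i , p) =
    let x , cert = ν⇒Certifies β b C T w i p in node w i x , refl , cert

  solve⇒Certifies m β b C T {v} p =
    -- The largest weight always works, because stage `n` is everything; small weights are selected
    -- only by `leastRank`.
    let x , _ , cert = stage⇒Certifies m β b C T (fromℕ n)
          (subst (λ w → stage (step m β C) C T (suc w) v) (sym (Finₚ.toℕ-fromℕ n))
            (Solve.stage-suc m β C n (Solve.solve⊆stage m β C p)))
    in x , cert

  Successor : ∀ {m} (β : Fin m → RabinPair n) → (b b′ : Targets β) → (C T : VertexSet) →
    Fin n → TreeRank n m → VertexSet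
  Successor β b b′ C T v x u = ∃ λ y → Certifies β b′ C T y u × TreeDescends v β b x y

  -- Stage 0 is empty, and stage `w + 1` is certified with head weight `w`, so the head drops.
  earlierStage : ∀ m (β : Fin m → RabinPair n) b b′ C T v x →
    stage (step m β C) C T (toℕ (headWeight x)) ⊆ Successor β b b′ C T v x
  earlierStage m β b b′ C T v x p = fromWeight (headWeight x) refl p
    where
    fromWeight : ∀ w → headWeight x ≡ w → ∀ {u} → stage (step m β C) C T (toℕ w) u →
      Successor β b b′ C T v x u
    fromWeight (suc w) eq {u} p =
      let y , eq′ , cert = stage⇒Certifies m β b′ C T (inject₁ w)
            (subst (λ w → stage (step m β C) C T (suc w) u) (sym (Finₚ.toℕ-inject₁ w)) p)
      in y , cert , head-decreases (ℕₚ.≤-reflexive (trans (cong (suc ∘ toℕ) eq′)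
           (trans (cong suc (Finₚ.toℕ-inject₁ w)) (cong toℕ (sym eq)))))

  -- Induction on the tree, by the reason the inner certificate gives. The outer target is passed
  -- upwards; an earlier stage lowers the head weight; a visit lets the inner part be certified
  -- afresh for the new target; otherwise the descent is deeper.
  Certifies⇒Successor : ∀ {m} (β : Fin m → RabinPair n) b b′ C T x v →
    (∀ i → v ∉ RabinPair.I (β i) (b i) → b′ i ≡ b i) → Certifies β b C T x v →
    T v ⊎ (C v × cpre (Successor β b b′ C T v x) v)
  Certifies⇒Successor β b b′ C T (leaf w) v keep (inj₁ t) = inj₁ t
  Certifies⇒Successor β b b′ C T (leaf w) v keep (inj₂ (c , p)) =
    inj₂ (c , cpre-mono (earlierStage 0 β b b′ C T v (leaf w)) p)
  Certifies⇒Successor {suc m} β b b′ C T (node w i x) v keep (_ , cert)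
    with Certifies⇒Successor (β ∘ punchIn i) (b ∘ punchIn i) (b′ ∘ punchIn i) _ _ x v (keep ∘ punchIn i) cert
  ... | inj₁ (inj₁ (inj₁ t)) = inj₁ t
  ... | inj₁ (inj₁ (inj₂ (c , p))) =
    inj₂ (c , cpre-mono (earlierStage (suc m) β b b′ C T v (node w i x)) p)
  ... | inj₁ (inj₂ ((c , v∉F) , v∈I , p)) = inj₂ (c , cpre-mono successor p)
    where
    successor : ν β i C (below (suc m) β C T w) ⊆ Successor β b b′ C T v (node w i x)
    successor q = let y , cert′ = ν⇒Certifies β b′ C T w i q in node w i y , cert′ , visits v∉F v∈I
  ... | inj₂ ((c , v∉F) , p) = inj₂ (c , cpre-mono (λ (y , q) → successor y q) p)
    where
    T′ = below (suc m) β C T w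
    -- Reaching the current target changes the targets of the pairs below i, but
    -- by ν-fold the successor still lies in the fixpoint of i.
    successor : ∀ y {u} →
      Certifies (β ∘ punchIn i) (b′ ∘ punchIn i) (stay β i C) (exit β i C T′ (b i) (ν β i C T′)) y u ×
      TreeDescends v (β ∘ punchIn i) (b ∘ punchIn i) x y →
      Successor β b b′ C T v (node w i x) u
    successor y {u} (cert′ , desc) with ν-fold β i (b i) (Certifies⇒solve _ _ _ _ y cert′)
    ... | q with v ∈? RabinPair.I (β i) (b i)
    ...   | yes v∈I = let z , cert″ = ν⇒Certifies β b′ C T w i q in node w i z , cert″ , visits v∉F v∈I
    ...   | no v∉I  =
      node w i y
      , (q , subst (λ j → Certifies (β ∘ punchIn i) (b′ ∘ punchIn i) (stay β i C)
               (exit β i C T′ j (ν β i C T′)) y u) (sym (keep i v∉I)) cert′)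
      , deeper v∉F desc

  module _ {k : ℕ} (P : TreeRank n k → Set) where
    private
      open module R = TotalOrder (rankOrder n k) using () renaming (_≤_ to _≤ᴿ_)

      leastTree : ∃ P → ∃ λ x → P x × (∀ y → P y → [ toFiniteRank x ] ≤ᴿ [ toFiniteRank y ])
      leastTree (x , p)
        with leastˡᵉˣ {P = λ xs → ∃ λ x → P x × FiniteRank.sequence (toFiniteRank x) ≡ xs} _ (x , p , refl)
      ... | _ , (y , q , refl) , min = y , q , λ z r → Supremum.[ min _ (z , r , refl) ]

    leastRank : Rank n k
    leastRank with em {∃ P}
    ... | yes p = [ toFiniteRank (proj₁ (leastTree p)) ]
    ... | no _  = ∞

    leastRank-≤ : ∀ {y} → P y → leastRank ≤ᴿ [ toFiniteRank y ]
    leastRank-≤ {y} q with em {∃ P}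
    ... | yes p = proj₂ (proj₂ (leastTree p)) y q
    ... | no ¬p = contradiction (y , q) ¬p

    leastRank-attained : leastRank ≢ ∞ → ∃ λ x → P x × leastRank ≡ [ toFiniteRank x ]
    leastRank-attained finite with em {∃ P}
    ... | yes p = let x , q , _ = leastTree p in x , q , refl
    ... | no _  = contradiction refl finite

    leastRank-finite : ∃ P → leastRank ≢ ∞
    leastRank-finite p with em {∃ P}
    ... | yes _ = λ ()
    ... | no ¬p = contradiction p ¬p

  module _ {k : ℕ} (α : Condition n k) where
    private
      module R = TotalOrder (rankOrder n k)

      Certified : Fin n → DegenDomain α → TreeRank n k → Set
      Certified v b x = Certifies (lookup α) (b !_) U ∅ x v

    leastRanking : Ranking M α
    leastRanking (v , b) = leastRank (Certified v b)

    -- A successor's certified rank bounds its least rank. Player 0 needs one such successor, as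
    -- `next` is a minimum; for Player 1 the successor attaining the maximum is taken.
    leastRanking-good : Good M α leastRanking
    leastRanking-good v b finite with leastRank-attained (Certified v b) finite
    ... | x , cert , eq
      with Certifies⇒Successor (lookup α) (b !_) (nextᴮ v b !_) U ∅ x v (nextᴮ-∉ v b) cert
    -- The outermost target is empty, which rules out the other alternative.
    ...   | inj₂ (_ , some , every) =
      subst (λ y → RankDescends {α = α} v b y next) (sym eq) (byCases (v ∈? V₀))
      where
      next = nextᴿ M α leastRanking (v , b)

      descend : ∀ {u} → Successor (lookup α) (b !_) (nextᴮ v b !_) U ∅ v x u →
        next R.≤ leastRanking (u , nextᴮ v b) → RankDescends {α = α} v b [ toFiniteRank x ] next
      descend {u} (y , cert′ , desc) le = RankDescends-≥ [ TreeDescends⇒FiniteDescends {α = α} {b = b} desc ]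
        (R.trans le (leastRank-≤ (Certified u (nextᴮ v b)) cert′))

      byCases : Dec (v ∈ V₀) → RankDescends {α = α} v b [ toFiniteRank x ] next
      byCases (yes v∈V₀) = let u , u∈E , successor = some v∈V₀ in
        descend successor (nextᴿ-V₀-≤ {M = M} leastRanking v∈V₀ u∈E)
      byCases (no v∉V₀) = let u , u∈E , attained = nextᴿ-attained {M = M} leastRanking v b in
        descend (every v∉V₀ u∈E) (R.reflexive (R.Eq.reflexive attained))

    leastRanking-finite : ∀ {v} b → solve (step k (lookup α) U) U ∅ v → leastRanking (v , b) ≢ ∞
    leastRanking-finite {v} b p =
      leastRank-finite (Certified v b) (solve⇒Certifies k (lookup α) (b !_) U ∅ p)

-- Histories as a transition system, and the equivalence.

module _ (em : ExcludedMiddle 0ℓ) {n k : ℕ} (M : Game n) (α : Condition n k) where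
  open Game M
  open Fixpoints em M
  open Classical em using (Satisfies⇒Rabin)

  wins⇒solve : ∀ {v} → Player0Wins M α v → solve (step k (lookup α) U) U ∅ v
  wins⇒solve {v₀} (f , winning) = WinsFrom⇒solve k (lookup α) U ∅ ([] , v₀) winsFrom
    where
    History : Set
    History = List (Fin n) × Fin n

    _⟶_ : History → History → Set
    (h , v) ⟶ (h′ , u) = h′ ≡ h ∷ʳ v × u ∈ E v × (v ∈ V₀ → u ≡ proj₁ (f h v))

    total : ∀ s → ∃ (s ⟶_)
    -- A strategy proposes an edge at the vertices of Player 1 too.
    total (h , v) = (h ∷ʳ v , proj₁ (f h v)) , refl , proj₂ (f h v) , λ _ → refl

    cpre-⟶ : ∀ s (Y : VertexSet) → (∀ {s′} → s ⟶ s′ → Y (proj₂ s′)) → cpre Y (proj₂ s)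
    cpre-⟶ (h , v) Y next =
      (λ _ → _ , proj₂ (f h v) , next (refl , proj₂ (f h v) , λ _ → refl)) ,
      λ v∉V₀ u∈E → next (refl , u∈E , λ v∈V₀ → contradiction v∈V₀ v∉V₀)

    open Completeness em M proj₂ _⟶_ total cpre-⟶

    winsFrom : WinsFrom (lookup α) U ∅ ([] , v₀)
    winsFrom σ σ₀ path = inj₂ ((λ _ → tt) , Satisfies⇒Rabin {α = α} (winning ρ (cong proj₂ σ₀) conforms))
      where
      ρ = proj₂ ∘ σ

      history : ∀ t → proj₁ (σ t) ≡ applyUpTo ρ t
      history zero    = cong proj₁ σ₀
      history (suc t) = trans (proj₁ (path t))
        (trans (cong (_∷ʳ ρ t) (history t)) (Listₚ.applyUpTo-∷ʳ ρ t))

      conforms : Conforms M f ρ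
      conforms = record
        { edge   = λ t → proj₁ (proj₂ (path t))
        ; follow = λ t ρt∈V₀ → trans (proj₂ (proj₂ (path t)) ρt∈V₀)
                                 (cong (λ h → proj₁ (f h (ρ t))) (history t))
        }

initial : ∀ {n k} (α : Condition n k) → DegenDomain α
initial α = lookup⁻ λ i → first (lookup α i)
  where
  first : ∀ {n} (p : RabinPair n) → Fin (RabinPair.len p)
  first record { len = len ; len-nonZero = nonZero } = fromℕ< (>-nonZero⁻¹ len {{nonZero}})

theorem17 : ExcludedMiddle 0ℓ →
    ∀ {n k : ℕ} .{{_ : NonZero k}} (M : Game n) (α : Condition n k) (v : Fin n) →
    Player0Wins M α v ⇔
    (∃ λ (r : Ranking M α) → Good M α r × ∃ λ (b : DegenDomain α) → r (v , b) ≢ ∞)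
theorem17 em M α v = mk⇔
  (λ wins → leastRanking α , leastRanking-good α , initial α ,
    leastRanking-finite α (initial α) (wins⇒solve em M α wins))
  (λ (r , good , b , finite) → Classical.goodRanking⇒wins em M α r good {b₀ = b} finite)
  where open Ranks em M
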